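{- For any prime $p\equiv 1\pmod 4$, $$\left(\frac{\sqrt{S_{1+\frac{p-1}{2},2}(-1,p)}}{p}\right)=(-1)^{\left|\left\{0<r<\frac{p}{4}\,:\,\left(\frac{r}{p}\right)=-1\right\}\right|}\left(\frac{p}{3}\right),$$ where $r$ ranges over integers.
   Context: For an odd prime $p$, let $\alpha_1,\ldots,\alpha_{(p-1)/2}$ be integers representing the distinct (nonzero) quadratic residues modulo $p$, and for $n\in\mathbb{N}$, $d\in\mathbb{Z}$ put $$S_{n,2}(d,p)=\det\left[(\alpha_i+d\,\alpha_j)^n\right]_{1\le i,j\le \frac{p-1}{2}}.$$ When $p\equiv 1\pmod 4$ and $n$ is odd, $S_{n,2}(-1,p)$ is the determinant of a skew-symmetric integer matrix of even order, hence the square of an integer, and $\sqrt{S_{n,2}(-1,p)}$ denotes its integer square root (the sign is immaterial inside the Legendre symbol since $p\equiv 1\pmod 4$). $\left(\frac{\cdot}{p}\right)$ and $\left(\frac{\cdot}{3}\right)$ are Legendre symbols. -}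

module Defs where

open import Data.Bool.Base using (if_then_else_)
open import Data.Fin.Base using (Fin; zero; suc; toℕ; punchIn)
open import Data.Fin.Properties using (any?)
open import Data.Integer.Base
  using (ℤ; +_; _+_; _-_; _*_; _^_; 0ℤ; 1ℤ; -1ℤ)
import Data.Integer.Properties as ℤ
open import Data.Integer.Divisibility.Signed using (_∣_; _∣?_)
open import Data.List.Base using (length; filter; upTo)
open import Data.Nat.Base as ℕ using (ℕ; zero; suc)
import Data.Nat.Properties as ℕ
open import Data.Product.Base using (∃; _×_)
open import Relation.Binary.PropositionalEquality using (_≡_)
open import Relation.Nullary using (Dec; ¬_; does; _×-dec_)
open import Algebra.Properties.Semiring.Sum ℤ.+-*-semiring using (sum-syntax)

infix 4 _≡_[mod_]

_≡_[mod_] : ℤ → ℤ → ℕ → Set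
a ≡ b [mod p ] = + p ∣ a - b

-- The square root ranges over the reduced residues 0, …, p-1, which
-- makes the predicate decidable by search.
IsSquareMod : ℕ → ℤ → Set
IsSquareMod p a = ∃ λ (x : Fin p) → (+ toℕ x) ^ 2 ≡ a [mod p ]

isSquareMod? : ∀ p a → Dec (IsSquareMod p a)
isSquareMod? p a = any? λ x → + p ∣? (+ toℕ x) ^ 2 - a

IsQuadraticResidue : ℕ → ℤ → Set
IsQuadraticResidue p a = ¬ (+ p ∣ a) × IsSquareMod p a

-- The Legendre symbol (a / p).  Defined for every p, but only meaningful
-- when p is an odd prime.
legendre : ℤ → ℕ → ℤ
legendre a p =
  if does (+ p ∣? a) then 0ℤ
  else if does (isSquareMod? p a) then 1ℤ
  else -1ℤ

half : ℕ → ℕ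
half p = (p ℕ.∸ 1) ℕ./ 2

record RepresentsResidues (p : ℕ) (α : Fin (half p) → ℤ) : Set where
  field
    residue  : ∀ i → IsQuadraticResidue p (α i)
    distinct : ∀ {i j} → α i ≡ α j [mod p ] → i ≡ j
    complete : ∀ a → IsQuadraticResidue p a → ∃ λ i → α i ≡ a [mod p ]

Matrix : ℕ → Set
Matrix n = Fin n → Fin n → ℤ

-- Laplace expansion along the first row.
det : ∀ {n} → Matrix n → ℤ
det {zero}  M = 1ℤ
det {suc n} M =
  ∑[ j < suc n ]
    (-1ℤ ^ toℕ j * M zero j * det (λ i k → M (suc i) (punchIn j k)))

-- S n α d is the determinant S_{n,2}(d, p), where α lists representatives
-- of the quadratic residues modulo p.
S : ∀ {m} → ℕ → (Fin m → ℤ) → ℤ → ℤ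
S n α d = det λ i j → (α i + d * α j) ^ n

-- | { 0 < r < p/4 : (r / p) = -1 } |, with r < p/4 written as 4 r < p.
-- Listing only r < p loses nothing, since r ≤ 4 r.
nonresiduesBelowQuarter : ℕ → ℕ
nonresiduesBelowQuarter p =
  length (filter (λ r → (0 ℕ.<? r) ×-dec (4 ℕ.* r ℕ.<? p)
                        ×-dec (legendre (+ r) p ℤ.≟ -1ℤ))
                 (upTo p))

{-# OPTIONS --safe #-}

-- Write m = (p - 1)/2 = 2K and n = m + 1.  Modulo p the monomials x^b with
-- b < m form a basis of the functions on the residues, and expanding
-- (x - y)^n by the binomial theorem, with x^m = 1 and the orthogonality of
-- the power sums of the residues, shows that the matrix sends x^b to a
-- multiple d_b of x^(b+1).  It is therefore similar to a weighted cyclic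
-- shift of even order, and its determinant is -∏ d_b; the same argument for
-- the diagonal matrix of the residues gives ∏ α = -1, hence (m!)² = -1.
-- If s² is the determinant, then (s/p) = s^m = det^K.  The binomial
-- coefficients in the weights d_b contribute K! up to squares, and the two
-- exceptional weights d_0 and d_(m-1) contribute m + 2, that is 3/2, so
-- that (s/p) = (3/p)(K!/p).
--
-- That s exists over ℤ follows from symplectic elimination: it makes the
-- determinant of a skew-symmetric matrix of even order a rational square.
module Submission where

open import Defs
open import Algebra.Bundles using (CommutativeMonoid)
open import Data.Bool.Base using (true; false; if_then_else_)
open import Data.Empty using (⊥; ⊥-elim)
open import Data.Fin.Base as Fin using (Fin; zero; suc; toℕ; fromℕ; fromℕ<; inject₁; inject≤; punchIn; punchOut)
import Data.Fin.Properties as Fin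
open import Data.Integer.Base as ℤ using (ℤ; +_; _+_; _-_; _*_; _^_; -_; 0ℤ; 1ℤ; -1ℤ; ∣_∣)
import Data.Integer.DivMod as ℤ
import Data.Integer.Properties as ℤ
open import Data.Integer.Divisibility.Signed using (_∣_; _∣?_; divides; ∣⇒∣ᵤ; ∣ᵤ⇒∣; ∣m∣n⇒∣m+n; ∣m⇒∣-m; ∣n⇒∣m*n)
open import Data.Integer.Tactic.RingSolver using (solve-∀)
open import Data.List.Base as List using (length; filter; upTo)
import Data.List.Properties as List
open import Data.Nat.Base as ℕ using (ℕ; zero; suc; _!)
open import Data.Nat.Coprimality using (Coprime; coprime-/gcd; coprime-divisor)
import Data.Nat.Divisibility as ℕ
import Data.Nat.DivMod as ℕ
open import Data.Nat.GCD using (gcd; gcd[m,n]∣m; gcd[m,n]∣n; gcd[m,n]≡0⇒m≡0)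
open import Data.Nat.Primality using (Prime; euclidsLemma; prime⇒irreducible; prime⇒nonZero; prime⇒nonTrivial)
import Data.Nat.Properties as ℕ
open import Data.Nat.Tactic.RingSolver renaming (solve-∀ to ℕ-solve-∀)
open import Data.Product.Base using (∃; ∃₂; _×_; _,_; proj₁; proj₂)
open import Data.Sum.Base using (_⊎_; inj₁; inj₂)
open import Function.Base using (_∘_)
open import Relation.Binary.Bundles using (Setoid)
open import Relation.Binary.Definitions using (tri<; tri≈; tri>)
open import Relation.Binary.PropositionalEquality
import Relation.Binary.Reasoning.Setoid as SetoidReasoning
open import Relation.Nullary using (¬_; Dec; yes; no; does; contradiction; ¬?; _×-dec_)
open import Relation.Nullary.Decidable using (map′; decidable-stable; dec-true; dec-false)
import Algebra.Properties.CommutativeSemiring.Binomial ℤ.+-*-commutativeSemiring as Binomial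
import Algebra.Properties.Semiring.Exp ℤ.+-*-semiring as Exp
import Algebra.Properties.Semiring.Mult ℤ.+-*-semiring as Mult
open import Algebra.Properties.Semiring.Sum ℤ.+-*-semiring using (sum; sum-syntax; sum-cong-≗; sum-init-last; sum-replicate-zero; ∑-distrib-+; ∑-comm; *-distribˡ-sum; *-distribʳ-sum)
open import Algebra.Properties.CommutativeMonoid.Sum ℤ.*-1-commutativeMonoid using () renaming (sum to ∏; sum-init-last to ∏-init-last; sum-cong-≗ to ∏-cong-≗)

-- No Pfaffian is evaluated and no choice of root enters, because only the K-th power of the
-- determinant is needed. Symbols modulo p are handled as m-th powers (Euler's criterion), and the
-- stray constants are harmless because 2, m, m + 1 and m! all have the same quadratic character
-- (-1)^K. Modulo p the determinant is -(m + 2)² times a product of binomial coefficients; the K-th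
-- power of this -1 is (-1)^K = (2/p), which turns the 3/2 of the exceptional weights into 3.
--
-- Two translations remain. Since p = 4K + 1, the condition r < p/4 means r ≤ K, and (K!/p) is the
-- product of (r/p) over these r. The equality (3/p) = (p/3) is obtained without reciprocity: -1 is
-- a square, so 3 is a square exactly when -3 is, that is, when there is a primitive cube root of
-- unity modulo p, and this happens exactly when 3 divides p - 1. Both sides of the theorem are 0, 1
-- or -1, so a congruence modulo p is enough.

module Determinant where
  open import Data.Vec.Functional using (_∷_; insertAt; updateAt)
  open import Data.Vec.Functional.Properties using (updateAt-updates; updateAt-minimal)
  open ≡-Reasoning

  -- Determinants as alternating multilinear functions of the rows

  ∑-zero : ∀ {n} {f : Fin n → ℤ} → (∀ i → f i ≡ 0ℤ) → ∑[ i < n ] f i ≡ 0ℤ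
  ∑-zero {n} f≡0 = trans (sum-cong-≗ f≡0) (sum-replicate-zero n)

  ∑-linear : ∀ {n} c (f g : Fin n → ℤ) →
    ∑[ i < n ] (f i + c * g i) ≡ ∑[ i < n ] f i + c * ∑[ i < n ] g i
  ∑-linear c f g =
    trans (∑-distrib-+ f (λ i → c * g i)) (cong (λ x → sum f + x) (sym (*-distribˡ-sum c g)))

  Row : ℕ → Set
  Row n = Fin n → ℤ

  -- Matrices are functions known only pointwise, so invariance under pointwise equality is a field
  -- and `linear` relates three matrices by equations between entries. Rows may have a length
  -- different from their number, because fixing a first row leaves fewer rows of the same length.
  record IsMultilinear {n m} (f : (Fin n → Row m) → ℤ) : Set where
    field
      ext : ∀ {A B} → (∀ i j → A i j ≡ B i j) → f A ≡ f B
      linear : ∀ r c {A B C} →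
        (∀ i → i ≢ r → ∀ j → A i j ≡ B i j) →
        (∀ i → i ≢ r → ∀ j → A i j ≡ C i j) →
        (∀ j → A r j ≡ B r j + c * C r j) →
        f A ≡ f B + c * f C

    -- A zero row is the sum of itself and itself, so linearity with all three matrices equal to `A`
    -- gives f A = f A + f A.
    zero-row : ∀ {A} r → (∀ j → A r j ≡ 0ℤ) → f A ≡ 0ℤ
    zero-row {A} r Ar≡0 = self-cancel (linear r 1ℤ {A} {A} {A} (λ _ _ _ → refl) (λ _ _ _ → refl)
      λ j → trans (Ar≡0 j) (sym (cong₂ (λ x y → x + 1ℤ * y) (Ar≡0 j) (Ar≡0 j))))
      where
      shift : ∀ x → x + 1ℤ * x - x ≡ x
      shift = solve-∀
      self-cancel : ∀ {x} → x ≡ x + 1ℤ * x → x ≡ 0ℤ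
      self-cancel {x} eq = trans (sym (shift x)) (trans (cong (_- x) (sym eq)) (ℤ.+-inverseʳ x))

    -- Vanishing is assumed for the two rows `r` and `s` only: the induction that proves `det`
    -- alternating already uses this lemma, at a point where just some pairs of rows have been
    -- treated.
    add-row : ∀ {r s} c {A B} → r ≢ s →
      (∀ {C} → (∀ j → C r j ≡ C s j) → f C ≡ 0ℤ) →
      (∀ i → i ≢ r → ∀ j → A i j ≡ B i j) →
      (∀ j → A r j ≡ B r j + c * B s j) → f A ≡ f B
    add-row {r} {s} c {A} {B} r≢s repeated A≡B Ar = begin
      f A           ≡⟨ linear r c A≡B
                        (λ i i≢r j → trans (A≡B i i≢r j) (sym (C-else i i≢r j)))
                        (λ j → trans (Ar j) (cong (λ x → B r j + c * x) (sym (C-r j)))) ⟩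
      f B + c * f C ≡⟨ cong (λ x → f B + c * x)
                        (repeated λ j → trans (C-r j) (sym (C-else s (r≢s ∘ sym) j))) ⟩
      f B + c * 0ℤ  ≡⟨ drop (f B) c ⟩
      f B           ∎
      where
      drop : ∀ x c → x + c * 0ℤ ≡ x
      drop = solve-∀
      C : Fin n → Row m
      C = updateAt B r λ _ → B s
      C-r : ∀ j → C r j ≡ B s j
      C-r = cong-app (updateAt-updates r B)
      C-else : ∀ i → i ≢ r → ∀ j → C i j ≡ B i j
      C-else i i≢r = cong-app (updateAt-minimal i r B i≢r)

  record IsAlternating {n m} (f : (Fin n → Row m) → ℤ) : Set where
    field
      isMultilinear : IsMultilinear f
      repeated : ∀ {A} r s → r ≢ s → (∀ j → A r j ≡ A s j) → f A ≡ 0ℤ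
    open IsMultilinear isMultilinear public

  minor : ∀ {n} → Matrix (suc n) → Fin (suc n) → Matrix n
  minor M j i k = M (suc i) (punchIn j k)

  det-ext : ∀ {n} {A B : Matrix n} → (∀ i j → A i j ≡ B i j) → det A ≡ det B
  det-ext {zero}  A≡B = refl
  det-ext {suc n} A≡B = sum-cong-≗ λ j → cong₂ _*_
    (cong (-1ℤ ^ toℕ j *_) (A≡B zero j))
    (det-ext λ i k → A≡B (suc i) (punchIn j k))

  det-linear : ∀ {n} (r : Fin n) c {A B C : Matrix n} →
    (∀ i → i ≢ r → ∀ j → A i j ≡ B i j) →
    (∀ i → i ≢ r → ∀ j → A i j ≡ C i j) →
    (∀ j → A r j ≡ B r j + c * C r j) →
    det A ≡ det B + c * det C
  det-linear {suc n} r c {A} {B} {C} A≡B A≡C Ar = begin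
    det A                                   ≡⟨ sum-cong-≗ (terms r A≡B A≡C Ar) ⟩
    ∑[ j < suc n ] (term B j + c * term C j) ≡⟨ ∑-linear c (term B) (term C) ⟩
    det B + c * det C                       ∎
    where
    term : Matrix (suc n) → Fin (suc n) → ℤ
    term M j = -1ℤ ^ toℕ j * M zero j * det (minor M j)

    expand₀ : ∀ s b d c x → s * (b + c * d) * x ≡ s * b * x + c * (s * d * x)
    expand₀ = solve-∀

    expand₊ : ∀ s a c x y → s * a * (x + c * y) ≡ s * a * x + c * (s * a * y)
    expand₊ = solve-∀

    terms : ∀ r →
      (∀ i → i ≢ r → ∀ j → A i j ≡ B i j) →
      (∀ i → i ≢ r → ∀ j → A i j ≡ C i j) →
      (∀ j → A r j ≡ B r j + c * C r j) → ∀ j → term A j ≡ term B j + c * term C j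
    terms zero A≡B A≡C Ar j = begin
      s * A zero j * det (minor A j)
        ≡⟨ cong (λ a → s * a * det (minor A j)) (Ar j) ⟩
      s * (B zero j + c * C zero j) * det (minor A j)
        ≡⟨ expand₀ s (B zero j) (C zero j) c (det (minor A j)) ⟩
      s * B zero j * det (minor A j) + c * (s * C zero j * det (minor A j))
        ≡⟨ cong₂ (λ x y → s * B zero j * x + c * (s * C zero j * y))
             (det-ext λ i k → A≡B (suc i) (λ ()) (punchIn j k))
             (det-ext λ i k → A≡C (suc i) (λ ()) (punchIn j k)) ⟩
      term B j + c * term C j ∎
      where s = -1ℤ ^ toℕ j
    terms (suc r) A≡B A≡C Ar j = begin
      s * A zero j * det (minor A j)
        ≡⟨ cong (s * A zero j *_)
             (det-linear r c
               (λ i i≢r k → A≡B (suc i) (i≢r ∘ Fin.suc-injective) (punchIn j k))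
               (λ i i≢r k → A≡C (suc i) (i≢r ∘ Fin.suc-injective) (punchIn j k))
               (λ k → Ar (punchIn j k))) ⟩
      s * A zero j * (det (minor B j) + c * det (minor C j))
        ≡⟨ expand₊ s (A zero j) c (det (minor B j)) (det (minor C j)) ⟩
      s * A zero j * det (minor B j) + c * (s * A zero j * det (minor C j))
        ≡⟨ cong₂ (λ x y → s * x * det (minor B j) + c * (s * y * det (minor C j)))
             (A≡B zero (λ ()) j) (A≡C zero (λ ()) j) ⟩
      term B j + c * term C j ∎
      where s = -1ℤ ^ toℕ j

  -- The double Laplace expansion along two equal rows v: the pairs (j , l)
  -- and (l , j) of deleted columns leave the same columns and cancel.
  double-expansion : ∀ n (v : Row (suc (suc n))) (Φ : (Fin n → Fin (suc (suc n))) → ℤ) →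
    (∀ φ ψ → φ ≗ ψ → Φ φ ≡ Φ ψ) →
    ∑[ j < suc (suc n) ] ∑[ k < suc n ]
      (-1ℤ ^ toℕ j * v j * (-1ℤ ^ toℕ k * v (punchIn j k)) *
       Φ (punchIn j ∘ punchIn k)) ≡ 0ℤ
  double-expansion n v Φ Φ-ext = begin
    R + ∑[ j < suc n ] (c j + ∑[ k < n ] t j k)
      ≡⟨ cong (λ x → R + x) (∑-distrib-+ c (λ j → ∑[ k < n ] t j k)) ⟩
    R + (∑[ j < suc n ] c j + ∑[ j < suc n ] ∑[ k < n ] t j k)
      ≡⟨ sym (ℤ.+-assoc R _ _) ⟩
    R + ∑[ j < suc n ] c j + ∑[ j < suc n ] ∑[ k < n ] t j k
      ≡⟨ cong₂ _+_ cancel (rest n v Φ Φ-ext) ⟩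
    0ℤ ∎
    where
    T : Fin (suc (suc n)) → Fin (suc n) → ℤ
    T j k = -1ℤ ^ toℕ j * v j * (-1ℤ ^ toℕ k * v (punchIn j k)) * Φ (punchIn j ∘ punchIn k)
    R = ∑[ k < suc n ] T zero k
    c : Fin (suc n) → ℤ
    c j = T (suc j) zero
    t : Fin (suc n) → Fin n → ℤ
    t j k = T (suc j) (suc k)

    opposite : ∀ s a b x → 1ℤ * a * (s * b) * x + -1ℤ * s * b * (1ℤ * a) * x ≡ 0ℤ
    opposite = solve-∀

    cancel : R + ∑[ j < suc n ] c j ≡ 0ℤ
    cancel = trans (sym (∑-distrib-+ (T zero) c)) (∑-zero λ k →
      opposite (-1ℤ ^ toℕ k) (v zero) (v (suc k)) (Φ (suc ∘ punchIn k)))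

    rest : ∀ n (v : Row (suc (suc n))) (Φ : (Fin n → Fin (suc (suc n))) → ℤ) →
      (∀ φ ψ → φ ≗ ψ → Φ φ ≡ Φ ψ) →
      ∑[ j < suc n ] ∑[ k < n ]
        (-1ℤ ^ suc (toℕ j) * v (suc j) * (-1ℤ ^ suc (toℕ k) * v (suc (punchIn j k))) *
         Φ (punchIn (suc j) ∘ punchIn (suc k))) ≡ 0ℤ
    rest zero    v Φ Φ-ext = refl
    rest (suc n) v Φ Φ-ext = trans
      (sum-cong-≗ λ j → sum-cong-≗ λ k → trans
        (signs (-1ℤ ^ toℕ j) (-1ℤ ^ toℕ k) (v (suc j)) (v (suc (punchIn j k))) _)
        (cong (-1ℤ ^ toℕ j * v (suc j) * (-1ℤ ^ toℕ k * v (suc (punchIn j k))) *_)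
          (Φ-ext (punchIn (suc j) ∘ punchIn (suc k)) (zero ∷ (suc ∘ punchIn j ∘ punchIn k))
            λ { zero → refl ; (suc _) → refl })))
      -- Column 0 survives both deletions, so the smaller sum uses the old minor with column 0 put
      -- back in front.
      (double-expansion n (v ∘ suc) (λ φ → Φ (zero ∷ (suc ∘ φ)))
        λ φ ψ φ≗ψ → Φ-ext _ _ λ { zero → refl ; (suc i) → cong suc (φ≗ψ i) })
      where
      signs : ∀ s s′ a b x → -1ℤ * s * a * (-1ℤ * s′ * b) * x ≡ s * a * (s′ * b) * x
      signs = solve-∀

  det-repeated₀₁ : ∀ {n} (A : Matrix (suc (suc n))) → (∀ j → A zero j ≡ A (suc zero) j) → det A ≡ 0ℤ
  det-repeated₀₁ {n} A A₀≡A₁ = trans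
    (sum-cong-≗ λ j → trans
      (*-distribˡ-sum (x j) (λ k → -1ℤ ^ toℕ k * A (suc zero) (punchIn j k) * D j k))
      (sum-cong-≗ λ k → trans
        (sym (ℤ.*-assoc (x j) (-1ℤ ^ toℕ k * A (suc zero) (punchIn j k)) (D j k)))
        (cong (λ a → x j * (-1ℤ ^ toℕ k * a) * D j k) (sym (A₀≡A₁ (punchIn j k))))))
    (double-expansion n (A zero) (λ φ → det λ i l → A (suc (suc i)) (φ l))
      λ φ ψ φ≗ψ → det-ext λ i l → cong (A (suc (suc i))) (φ≗ψ l))
    where
    x : Fin (suc (suc n)) → ℤ
    x j = -1ℤ ^ toℕ j * A zero j
    D : Fin (suc (suc n)) → Fin (suc n) → ℤ
    D j k = det λ i l → A (suc (suc i)) (punchIn j (punchIn k l))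

  det-isMultilinear : ∀ {n} → IsMultilinear (det {n})
  det-isMultilinear = record { ext = det-ext ; linear = det-linear }

  RowsRepeated : ℕ → Set
  RowsRepeated n = ∀ (A : Matrix n) r s → r ≢ s → (∀ j → A r j ≡ A s j) → det A ≡ 0ℤ

  minors-repeated : ∀ {n} → RowsRepeated n → ∀ (A : Matrix (suc n)) r s →
    suc r ≢ suc s → (∀ j → A (suc r) j ≡ A (suc s) j) → det A ≡ 0ℤ
  minors-repeated IH A r s r≢s Ar≡As = ∑-zero λ j → trans
    (cong (-1ℤ ^ toℕ j * A zero j *_)
      (IH (minor A j) r s (r≢s ∘ cong suc) (λ k → Ar≡As (punchIn j k))))
    (ℤ.*-zeroʳ (-1ℤ ^ toℕ j * A zero j))

  -- Rows (a , b , a) become (a , b , a - b) and then (a , a , a - b).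
  det-repeated₀₊ : ∀ {n} → RowsRepeated (suc n) → ∀ (A : Matrix (suc (suc n))) s →
    (∀ j → A zero j ≡ A (suc (suc s)) j) → det A ≡ 0ℤ
  det-repeated₀₊ {n} IH A s A₀≡As = begin
    det A ≡⟨ sym (add-row -1ℤ {B} {A} (λ ()) (λ {X} → minors-repeated IH X (suc s) zero λ ())
               (λ i i≢s → cong-app (updateAt-minimal i 2+s {f} A i≢s))
               (cong-app (updateAt-updates 2+s {f} A))) ⟩
    det B ≡⟨ sym (add-row 1ℤ {C} {B} (λ ()) (λ {X} → minors-repeated IH X zero (suc s) λ ())
               (λ i i≢1 → cong-app (updateAt-minimal i (suc zero) {g} B i≢1))
               (cong-app (updateAt-updates (suc zero) {g} B))) ⟩
    det C ≡⟨ det-repeated₀₁ C (λ j → begin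
               A zero j   ≡⟨ A₀≡As j ⟩
               A 2+s j    ≡⟨ telescope (A (suc zero) j) (A 2+s j) ⟩
               A (suc zero) j + 1ℤ * (A 2+s j + -1ℤ * A (suc zero) j)
                 ≡⟨ cong (λ x → A (suc zero) j + 1ℤ * x)
                      (sym (cong-app (updateAt-updates 2+s {f} A) j)) ⟩
               C (suc zero) j ∎) ⟩
    0ℤ    ∎
    where
    open IsMultilinear (det-isMultilinear {suc (suc n)})
    telescope : ∀ b a → a ≡ b + 1ℤ * (a + -1ℤ * b)
    telescope = solve-∀
    2+s : Fin (suc (suc n))
    2+s = suc (suc s)
    f g : Row (suc (suc n)) → Row (suc (suc n))
    B C : Matrix (suc (suc n))
    f Aₛ j = Aₛ j + -1ℤ * A (suc zero) j
    B = updateAt A 2+s f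
    g B₁ j = B₁ j + 1ℤ * B 2+s j
    C = updateAt B (suc zero) g

  det-repeated : ∀ {n} → RowsRepeated n
  det-repeated A zero zero r≢s _ = contradiction refl r≢s
  det-repeated A (suc r) (suc s) = minors-repeated det-repeated A r s
  det-repeated A zero (suc zero) _ = det-repeated₀₁ A
  det-repeated A (suc zero) zero _ A₁≡A₀ = det-repeated₀₁ A (sym ∘ A₁≡A₀)
  det-repeated A zero (suc (suc s)) _ = det-repeated₀₊ det-repeated A s
  det-repeated A (suc (suc r)) zero _ Ar≡A₀ = det-repeated₀₊ det-repeated A r (sym ∘ Ar≡A₀)

  det-isAlternating : ∀ {n} → IsAlternating (det {n})
  det-isAlternating = record { isMultilinear = det-isMultilinear ; repeated = λ {A} → det-repeated A }

  module _ {n m} {f : (Fin (suc n) → Row m) → ℤ} (f-alt : IsAlternating f) where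
    open IsAlternating f-alt

    ∷-isAlternating : ∀ v → IsAlternating (λ T → f (v ∷ T))
    ∷-isAlternating v = record
      { isMultilinear = record
        { ext = λ A≡B → ext λ { zero j → refl ; (suc i) j → A≡B i j }
        ; linear = λ r c A≡B A≡C Ar → linear (suc r) c
            (λ { zero _ j → refl ; (suc i) i≢r j → A≡B i (i≢r ∘ cong suc) j })
            (λ { zero _ j → refl ; (suc i) i≢r j → A≡C i (i≢r ∘ cong suc) j })
            Ar
        }
      ; repeated = λ r s r≢s → repeated (suc r) (suc s) (r≢s ∘ Fin.suc-injective)
      }

    linear₀ : ∀ {v} c {x y T} → (∀ j → v j ≡ x j + c * y j) →
      f (v ∷ T) ≡ f (x ∷ T) + c * f (y ∷ T)
    linear₀ c = linear zero c
      (λ { zero 0≢0 → contradiction refl 0≢0 ; (suc i) _ j → refl })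
      (λ { zero 0≢0 → contradiction refl 0≢0 ; (suc i) _ j → refl })

    linear₀-∑ : ∀ {k} (c : Fin k → ℤ) (V : Fin k → Row m) {v T} →
      (∀ j → v j ≡ ∑[ i < k ] (c i * V i j)) →
      f (v ∷ T) ≡ ∑[ i < k ] (c i * f (V i ∷ T))
    linear₀-∑ {zero}  c V v≡∑ = zero-row zero v≡∑
    linear₀-∑ {suc k} c V {v} {T} v≡∑ = begin
      f (v ∷ T) ≡⟨ linear₀ (c zero) {rest} {V zero}
                     (λ j → trans (v≡∑ j) (ℤ.+-comm (c zero * V zero j) (rest j))) ⟩
      f (rest ∷ T) + c zero * f (V zero ∷ T)
        ≡⟨ ℤ.+-comm (f (rest ∷ T)) (c zero * f (V zero ∷ T)) ⟩
      c zero * f (V zero ∷ T) + f (rest ∷ T)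
        ≡⟨ cong (λ x → c zero * f (V zero ∷ T) + x) (linear₀-∑ (c ∘ suc) (V ∘ suc) (λ j → refl)) ⟩
      ∑[ i < suc k ] (c i * f (V i ∷ T)) ∎
      where
      rest : Row m
      rest j = ∑[ i < k ] (c (suc i) * V (suc i) j)

  -- Polarization: put x + y into both rows. The value is 0, and so are the two terms with a
  -- repeated row; the mixed terms must cancel.
  swap₀₁ : ∀ {n m} {f : (Fin (suc (suc n)) → Row m) → ℤ} → IsAlternating f → ∀ x y T →
    f (x ∷ (y ∷ T)) ≡ - f (y ∷ (x ∷ T))
  swap₀₁ {f = f} f-alt x y T = solution (trans (sym expand)
      (repeated {A = x+y ∷ (x+y ∷ T)} zero (suc zero) (λ ()) λ j → refl))
    where
    open IsAlternating f-alt
    x+y : Row _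
    x+y j = x j + 1ℤ * y j
    expand : f (x+y ∷ (x+y ∷ T)) ≡ (0ℤ + 1ℤ * f (x ∷ (y ∷ T))) + 1ℤ * (f (y ∷ (x ∷ T)) + 1ℤ * 0ℤ)
    expand = begin
      f (x+y ∷ (x+y ∷ T)) ≡⟨ linear₀ f-alt 1ℤ (λ j → refl) ⟩
      f (x ∷ (x+y ∷ T)) + 1ℤ * f (y ∷ (x+y ∷ T))
        ≡⟨ cong₂ (λ a b → a + 1ℤ * b)
             (linear₀ (∷-isAlternating f-alt x) {x+y} 1ℤ {x} {y} (λ j → refl))
             (linear₀ (∷-isAlternating f-alt y) {x+y} 1ℤ {x} {y} (λ j → refl)) ⟩
      (f (x ∷ (x ∷ T)) + 1ℤ * f (x ∷ (y ∷ T))) + 1ℤ * (f (y ∷ (x ∷ T)) + 1ℤ * f (y ∷ (y ∷ T)))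
        ≡⟨ cong₂ (λ a b → (a + 1ℤ * f (x ∷ (y ∷ T))) + 1ℤ * (f (y ∷ (x ∷ T)) + 1ℤ * b))
             (repeated {A = x ∷ (x ∷ T)} zero (suc zero) (λ ()) (λ j → refl))
             (repeated {A = y ∷ (y ∷ T)} zero (suc zero) (λ ()) (λ j → refl)) ⟩
      _ ∎
    difference : ∀ a b → a ≡ ((0ℤ + 1ℤ * a) + 1ℤ * (b + 1ℤ * 0ℤ)) + - b
    difference = solve-∀
    solution : ∀ {a b} → (0ℤ + 1ℤ * a) + 1ℤ * (b + 1ℤ * 0ℤ) ≡ 0ℤ → a ≡ - b
    solution {a} {b} eq = trans (difference a b) (trans (cong (_+ - b) eq) (ℤ.+-identityˡ (- b)))

  -- Row j reaches the front by j adjacent swaps. This is where the cofactor signs come from.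
  cycle-rows : ∀ {n m} {f : (Fin (suc n) → Row m) → ℤ} → IsAlternating f → ∀ u j →
    f (u j ∷ (u ∘ punchIn j)) ≡ -1ℤ ^ toℕ j * f u
  cycle-rows {f = f} f-alt u zero = trans
    (IsAlternating.ext f-alt λ { zero j → refl ; (suc i) j → refl }) (sym (ℤ.*-identityˡ (f u)))
  cycle-rows {suc n} {f = f} f-alt u (suc j) = begin
    f (u (suc j) ∷ (u ∘ punchIn (suc j)))
      ≡⟨ ext (λ { zero _ → refl ; (suc zero) _ → refl ; (suc (suc i)) _ → refl }) ⟩
    f (u (suc j) ∷ (u zero ∷ (u ∘ suc ∘ punchIn j)))
      ≡⟨ swap₀₁ f-alt (u (suc j)) (u zero) (u ∘ suc ∘ punchIn j) ⟩
    - f (u zero ∷ (u (suc j) ∷ (u ∘ suc ∘ punchIn j)))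
      ≡⟨ cong -_ (cycle-rows (∷-isAlternating f-alt (u zero)) (u ∘ suc) j) ⟩
    - (-1ℤ ^ toℕ j * f (u zero ∷ (u ∘ suc)))
      ≡⟨ cong (λ x → - (-1ℤ ^ toℕ j * x)) (ext (λ { zero _ → refl ; (suc i) _ → refl })) ⟩
    - (-1ℤ ^ toℕ j * f u)
      ≡⟨ sign (-1ℤ ^ toℕ j) (f u) ⟩
    -1ℤ ^ suc (toℕ j) * f u ∎
    where
    open IsAlternating f-alt
    sign : ∀ s x → - (s * x) ≡ -1ℤ * s * x
    sign = solve-∀

  -- Uniqueness of alternating functions and multiplicativity of the determinant

  δ : ∀ {n} → Matrix n
  δ zero    zero    = 1ℤ
  δ zero    (suc _) = 0ℤ
  δ (suc _) zero    = 0ℤ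
  δ (suc i) (suc j) = δ i j

  δ-diag : ∀ {n} (i : Fin n) → δ i i ≡ 1ℤ
  δ-diag zero    = refl
  δ-diag (suc i) = δ-diag i

  δ-off : ∀ {n} {i j : Fin n} → i ≢ j → δ i j ≡ 0ℤ
  δ-off {i = zero}  {zero}  i≢j = contradiction refl i≢j
  δ-off {i = zero}  {suc j} i≢j = refl
  δ-off {i = suc i} {zero}  i≢j = refl
  δ-off {i = suc i} {suc j} i≢j = δ-off (i≢j ∘ cong suc)

  ∑-δˡ : ∀ {n} (i : Fin n) (f : Row n) → ∑[ j < n ] (δ i j * f j) ≡ f i
  ∑-δˡ zero    f = trans
    (cong₂ _+_ (ℤ.*-identityˡ (f zero)) (∑-zero λ j → ℤ.*-zeroˡ (f (suc j)))) (ℤ.+-identityʳ (f zero))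
  ∑-δˡ (suc i) f = trans
    (cong₂ _+_ (ℤ.*-zeroˡ (f zero)) (∑-δˡ i (f ∘ suc))) (ℤ.+-identityˡ (f (suc i)))

  ∑-δʳ : ∀ {n} (i : Fin n) (f : Row n) → ∑[ j < n ] (f j * δ j i) ≡ f i
  ∑-δʳ zero    f = trans
    (cong₂ _+_ (ℤ.*-identityʳ (f zero)) (∑-zero λ j → ℤ.*-zeroʳ (f (suc j)))) (ℤ.+-identityʳ (f zero))
  ∑-δʳ (suc i) f = trans
    (cong₂ _+_ (ℤ.*-zeroʳ (f zero)) (∑-δʳ i (f ∘ suc))) (ℤ.+-identityˡ (f (suc i)))

  -- The row `v` is not one of the rows of `A`: in the application it is the fixed first row of a
  -- larger matrix. Hence only the effect of adding a multiple of it to a single row is assumed.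
  clear-rows : ∀ {n m} {f : (Fin n → Row m) → ℤ} (v : Row m) →
    (∀ {A B} → (∀ i j → A i j ≡ B i j) → f A ≡ f B) →
    (∀ r c {A B} → (∀ i → i ≢ r → ∀ j → A i j ≡ B i j) →
      (∀ j → A r j ≡ B r j + c * v j) → f A ≡ f B) →
    ∀ (c : Fin n → ℤ) {A B} → (∀ i j → A i j ≡ B i j + c i * v j) → f A ≡ f B
  clear-rows {zero}  v ext step c A≡B = ext λ ()
  clear-rows {suc n} {f = f} v ext step c {A} {B} A≡B = begin
    f A                    ≡⟨ ext (λ { zero j → refl ; (suc i) j → refl }) ⟩
    f (A zero ∷ (A ∘ suc)) ≡⟨ clear-rows {f = λ T → f (A zero ∷ T)} v
      (λ A≡B → ext λ { zero j → refl ; (suc i) j → A≡B i j })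
      (λ r c A≡B → step (suc r) c
        (λ { zero _ j → refl ; (suc i) i≢r j → A≡B i (i≢r ∘ cong suc) j }))
      (c ∘ suc) {A ∘ suc} {B ∘ suc} (λ i → A≡B (suc i)) ⟩
    f (A zero ∷ (B ∘ suc)) ≡⟨ step zero (c zero)
      (λ { zero 0≢0 → contradiction refl 0≢0 ; (suc i) _ j → refl }) (A≡B zero) ⟩
    f B                    ∎

  -- Filling the deleted column with zeros turns a function of large matrices into a function of
  -- minors, to which induction applies.
  insert₀ : ∀ {n} → Fin (suc n) → Row n → Row (suc n)
  insert₀ j v = insertAt v j 0ℤ

  insert₀-linear : ∀ {n} (j : Fin (suc n)) c {u v w : Row n} → (∀ k → u k ≡ v k + c * w k) →
    ∀ k → insert₀ j u k ≡ insert₀ j v k + c * insert₀ j w k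
  insert₀-linear zero c u≡ zero = sym (trans (ℤ.+-identityˡ (c * 0ℤ)) (ℤ.*-zeroʳ c))
  insert₀-linear zero c u≡ (suc k) = u≡ k
  insert₀-linear {suc n} (suc j) c u≡ zero = u≡ zero
  insert₀-linear {suc n} (suc j) c u≡ (suc k) = insert₀-linear j c (u≡ ∘ suc) k

  insert₀-cong : ∀ {n} (j : Fin (suc n)) {u v : Row n} → (∀ k → u k ≡ v k) →
    ∀ k → insert₀ j u k ≡ insert₀ j v k
  insert₀-cong zero u≡v zero = refl
  insert₀-cong zero u≡v (suc k) = u≡v k
  insert₀-cong {suc n} (suc j) u≡v zero = u≡v zero
  insert₀-cong {suc n} (suc j) u≡v (suc k) = insert₀-cong j (u≡v ∘ suc) k

  insert₀-isAlternating : ∀ {n m} {f : (Fin n → Row (suc m)) → ℤ} → IsAlternating f →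
    ∀ j → IsAlternating (λ A → f (λ i → insert₀ j (A i)))
  insert₀-isAlternating f-alt j = record
    { isMultilinear = record
      { ext = λ A≡B → ext λ i → insert₀-cong j (A≡B i)
      ; linear = λ r c A≡B A≡C Ar → linear r c
          (λ i i≢r → insert₀-cong j (A≡B i i≢r))
          (λ i i≢r → insert₀-cong j (A≡C i i≢r))
          (insert₀-linear j c Ar)
      }
    ; repeated = λ r s r≢s Ar≡As → repeated r s r≢s (insert₀-cong j Ar≡As)
    }
    where open IsAlternating f-alt

  insert₀-removeAt : ∀ {n} (j : Fin (suc n)) (v : Row (suc n)) k →
    v k ≡ insert₀ j (v ∘ punchIn j) k + v j * δ j k
  insert₀-removeAt zero v zero = sym (trans (ℤ.+-identityˡ _) (ℤ.*-identityʳ (v zero)))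
  insert₀-removeAt zero v (suc k) =
    sym (trans (cong (λ x → v (suc k) + x) (ℤ.*-zeroʳ (v zero))) (ℤ.+-identityʳ (v (suc k))))
  insert₀-removeAt {suc n} (suc j) v zero =
    sym (trans (cong (λ x → v zero + x) (ℤ.*-zeroʳ (v (suc j)))) (ℤ.+-identityʳ (v zero)))
  insert₀-removeAt {suc n} (suc j) v (suc k) = insert₀-removeAt j (v ∘ suc) k

  insert₀-δ : ∀ {n} (j : Fin (suc n)) i k → insert₀ j (δ i) k ≡ δ (punchIn j i) k
  insert₀-δ zero i zero = refl
  insert₀-δ zero i (suc k) = refl
  insert₀-δ (suc j) zero zero = refl
  insert₀-δ (suc j) zero (suc k) = insert₀-0 j k
    where
    insert₀-0 : ∀ {n} (j : Fin (suc n)) k → insert₀ j (λ _ → 0ℤ) k ≡ 0ℤ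
    insert₀-0 zero zero = refl
    insert₀-0 zero (suc k) = refl
    insert₀-0 {suc n} (suc j) zero = refl
    insert₀-0 {suc n} (suc j) (suc k) = insert₀-0 j k
  insert₀-δ (suc j) (suc i) zero = refl
  insert₀-δ (suc j) (suc i) (suc k) = insert₀-δ j i k

  -- Expand the first row in unit rows. Below the unit row `δ j`, multiples of it clear column j;
  -- what is left is an alternating function of the minor, so induction gives its determinant times
  -- a constant, and moving `δ j` back into place supplies the sign of the Laplace expansion.
  alternating-unique : ∀ {n} {f : Matrix n → ℤ} → IsAlternating f → ∀ A → f A ≡ det A * f δ
  alternating-unique {zero}  {f} f-alt A =
    trans (IsAlternating.ext f-alt λ ()) (sym (ℤ.*-identityˡ (f δ)))
  alternating-unique {suc n} {f} f-alt A = begin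
    f A ≡⟨ ext (λ { zero j → refl ; (suc i) j → refl }) ⟩
    f (A zero ∷ (A ∘ suc))
      ≡⟨ linear₀-∑ f-alt (A zero) δ (λ j → sym (∑-δʳ j (A zero))) ⟩
    ∑[ j < suc n ] (A zero j * f (δ j ∷ (A ∘ suc)))
      ≡⟨ sum-cong-≗ (λ j → trans (cong (A zero j *_) (cofactor j))
           (rearrange (A zero j) (det (minor A j)) (-1ℤ ^ toℕ j) (f δ))) ⟩
    ∑[ j < suc n ] (-1ℤ ^ toℕ j * A zero j * det (minor A j) * f δ)
      ≡⟨ sym (*-distribʳ-sum (f δ) (λ j → -1ℤ ^ toℕ j * A zero j * det (minor A j))) ⟩
    det A * f δ ∎
    where
    open IsAlternating f-alt
    rearrange : ∀ a d s x → a * (d * (s * x)) ≡ s * a * d * x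
    rearrange = solve-∀
    cofactor : ∀ j → f (δ j ∷ (A ∘ suc)) ≡ det (minor A j) * (-1ℤ ^ toℕ j * f δ)
    cofactor j = begin
      f (δ j ∷ (A ∘ suc))
        ≡⟨ clear-rows {f = λ T → f (δ j ∷ T)} (δ j) (IsAlternating.ext (∷-isAlternating f-alt (δ j)))
             (λ r c A≡B Ar → add-row {s = zero} c (λ ()) (repeated (suc r) zero λ ())
               (λ { zero _ k → refl ; (suc i) i≢r k → A≡B i (i≢r ∘ cong suc) k }) Ar)
             (λ i → A (suc i) j) (λ i → insert₀-removeAt j (A (suc i))) ⟩
      f (δ j ∷ (λ i → insert₀ j (minor A j i)))
        ≡⟨ alternating-unique (insert₀-isAlternating (∷-isAlternating f-alt (δ j)) j) (minor A j) ⟩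
      det (minor A j) * f (δ j ∷ (λ i → insert₀ j (δ i)))
        ≡⟨ cong (det (minor A j) *_) (ext λ { zero k → refl ; (suc i) k → insert₀-δ j i k }) ⟩
      det (minor A j) * f (δ j ∷ (δ ∘ punchIn j))
        ≡⟨ cong (det (minor A j) *_) (cycle-rows f-alt δ j) ⟩
      det (minor A j) * (-1ℤ ^ toℕ j * f δ) ∎

  infixl 7 _⊗_

  _⊗_ : ∀ {n} → Matrix n → Matrix n → Matrix n
  (A ⊗ B) i k = ∑[ j < _ ] (A i j * B j k)

  -- For fixed `B`, the determinant of X ⊗ B is alternating in the rows of X, hence det X times its
  -- value det B at the identity.
  det-⊗ : ∀ {n} (A B : Matrix n) → det (A ⊗ B) ≡ det A * det B
  det-⊗ {n} A B = trans
    (alternating-unique {f = λ X → det (X ⊗ B)} (record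
      { isMultilinear = record
        { ext = λ X≡Y → det-ext λ i k → row-cong (X≡Y i) k
        ; linear = λ r c {X} {Y} {Z} X≡Y X≡Z Xr → det-linear r c {X ⊗ B} {Y ⊗ B} {Z ⊗ B}
            (λ i i≢r → row-cong (X≡Y i i≢r))
            (λ i i≢r → row-cong (X≡Z i i≢r))
            (λ k → row-linear {X r} {Y r} {Z r} c k Xr)
        }
      ; repeated = λ {X} r s r≢s Xr≡Xs → det-repeated (X ⊗ B) r s r≢s (row-cong Xr≡Xs)
      }) A)
    (cong (det A *_) (det-ext λ i k → ∑-δˡ i λ j → B j k))
    where
    row-cong : ∀ {u v : Row n} → (∀ j → u j ≡ v j) →
      ∀ k → ∑[ j < n ] (u j * B j k) ≡ ∑[ j < n ] (v j * B j k)
    row-cong u≡v k = sum-cong-≗ λ j → cong (_* B j k) (u≡v j)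
    distrib : ∀ y c z b → (y + c * z) * b ≡ y * b + c * (z * b)
    distrib = solve-∀
    row-linear : ∀ {u v w : Row n} c k → (∀ j → u j ≡ v j + c * w j) →
      ∑[ j < n ] (u j * B j k) ≡ ∑[ j < n ] (v j * B j k) + c * ∑[ j < n ] (w j * B j k)
    row-linear {v = v} {w} c k u≡ = trans
      (sum-cong-≗ λ j → trans (cong (_* B j k) (u≡ j)) (distrib (v j) c (w j) (B j k)))
      (∑-linear c (λ j → v j * B j k) (λ j → w j * B j k))

  -- Determinants of special matrices

  det-row₀ : ∀ {n} {A : Matrix (suc n)} → (∀ j → A zero (suc j) ≡ 0ℤ) →
    det A ≡ A zero zero * det (λ i k → A (suc i) (suc k))
  det-row₀ {n} {A} A₀≡0 = trans
    (cong₂ _+_ (cong (_* det (minor A zero)) (ℤ.*-identityˡ (A zero zero)))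
      (∑-zero λ j → trans
        (cong (λ a → -1ℤ ^ suc (toℕ j) * a * det (minor A (suc j))) (A₀≡0 j))
        (vanish (-1ℤ ^ suc (toℕ j)) _)))
    (ℤ.+-identityʳ _)
    where
    vanish : ∀ s d → s * 0ℤ * d ≡ 0ℤ
    vanish = solve-∀

  -- Mutual induction replaces a transposition argument: in the expansion along row 0, every minor
  -- but the first keeps column 0, and that column is zero there.
  det-zero-column : ∀ {n} {A : Matrix (suc n)} → (∀ i → A i zero ≡ 0ℤ) → det A ≡ 0ℤ
  det-column₀ : ∀ {n} {A : Matrix (suc n)} → (∀ i → A (suc i) zero ≡ 0ℤ) →
    det A ≡ A zero zero * det (λ i k → A (suc i) (suc k))

  det-zero-column {n} {A} A≡0 = trans (det-column₀ {A = A} (A≡0 ∘ suc))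
    (trans (cong (_* det (minor A zero)) (A≡0 zero)) (ℤ.*-zeroˡ (det (minor A zero))))

  det-column₀ {zero}  {A} A≡0 = trans (ℤ.+-identityʳ _) (cong (_* 1ℤ) (ℤ.*-identityˡ (A zero zero)))
  det-column₀ {suc n} {A} A≡0 = trans
    (cong₂ _+_ (cong (_* det (minor A zero)) (ℤ.*-identityˡ (A zero zero)))
      (∑-zero λ j → trans
        (cong (-1ℤ ^ suc (toℕ j) * A zero (suc j) *_) (det-zero-column {A = minor A (suc j)} A≡0))
        (ℤ.*-zeroʳ (-1ℤ ^ suc (toℕ j) * A zero (suc j)))))
    (ℤ.+-identityʳ _)

  det-diagonal : ∀ {n} (d : Fin n → ℤ) → det (λ i j → d j * δ i j) ≡ ∏ d
  det-diagonal {zero}  d = refl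
  det-diagonal {suc n} d = trans
    (det-row₀ {A = λ i j → d j * δ i j} λ j → ℤ.*-zeroʳ (d (suc j)))
    (cong₂ _*_ (ℤ.*-identityʳ (d zero)) (det-diagonal (d ∘ suc)))

  ∏-const : ∀ n a → ∏ {n} (λ _ → a) ≡ a ^ n
  ∏-const zero    a = refl
  ∏-const (suc n) a = cong (a *_) (∏-const n a)

  det-δ : ∀ {n} → det (δ {n}) ≡ 1ℤ
  det-δ {n} = trans (det-ext {n} λ i j → sym (ℤ.*-identityˡ (δ i j)))
    (trans (det-diagonal {n} λ _ → 1ℤ) (trans (∏-const n 1ℤ) (ℤ.^-zeroˡ n)))

  -- The cyclic predecessor. In the matrix of x^b ↦ x^(b+1), row i has its only entry in column i -
  -- 1.
  rotate : ∀ {n} → Fin n → Fin n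
  rotate {suc n} zero = fromℕ n
  rotate (suc i)      = inject₁ i

  toℕ-rotate : ∀ {n} (i : Fin n) →
    (toℕ i ≡ 0 × suc (toℕ (rotate i)) ≡ n) ⊎ toℕ i ≡ suc (toℕ (rotate i))
  toℕ-rotate {suc n} zero = inj₁ (refl , cong suc (Fin.toℕ-fromℕ n))
  toℕ-rotate (suc i)      = inj₂ (cong suc (sym (Fin.toℕ-inject₁ i)))

  punchIn-fromℕ : ∀ {n} (i : Fin n) → punchIn (fromℕ n) i ≡ inject₁ i
  punchIn-fromℕ zero    = refl
  punchIn-fromℕ (suc i) = cong suc (punchIn-fromℕ i)

  δ-inject₁ : ∀ {n} (i j : Fin n) → δ (inject₁ i) (inject₁ j) ≡ δ i j
  δ-inject₁ zero    zero    = refl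
  δ-inject₁ zero    (suc j) = refl
  δ-inject₁ (suc i) zero    = refl
  δ-inject₁ (suc i) (suc j) = δ-inject₁ i j

  -- Row 0 has its only entry in the last column; deleting both leaves a diagonal matrix.
  det-shift : ∀ {n} (d : Fin n → ℤ) →
    det (λ i j → d j * δ (rotate i) j) ≡ -1ℤ ^ ℕ.pred n * ∏ d
  det-shift {zero}  d = refl
  det-shift {suc n} d = begin
    det A
      ≡⟨ sum-cong-≗ (λ j → rearrange (-1ℤ ^ toℕ j) (d j) (δ (fromℕ n) j) (det (minor A j))) ⟩
    ∑[ j < suc n ] (δ (fromℕ n) j * (-1ℤ ^ toℕ j * d j * det (minor A j)))
      ≡⟨ ∑-δˡ (fromℕ n) (λ j → -1ℤ ^ toℕ j * d j * det (minor A j)) ⟩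
    -1ℤ ^ toℕ (fromℕ n) * d (fromℕ n) * det (minor A (fromℕ n))
      ≡⟨ cong₂ (λ e x → -1ℤ ^ e * d (fromℕ n) * x) (Fin.toℕ-fromℕ n)
           (trans (det-ext λ i k → trans
               (cong (λ l → d l * δ (inject₁ i) l) (punchIn-fromℕ k))
               (cong (d (inject₁ k) *_) (δ-inject₁ i k)))
             (det-diagonal (d ∘ inject₁))) ⟩
    -1ℤ ^ n * d (fromℕ n) * ∏ (d ∘ inject₁)
      ≡⟨ collect (-1ℤ ^ n) (d (fromℕ n)) (∏ (d ∘ inject₁)) ⟩
    -1ℤ ^ n * (∏ (d ∘ inject₁) * d (fromℕ n))
      ≡⟨ cong (-1ℤ ^ n *_) (sym (∏-init-last d)) ⟩
    -1ℤ ^ n * ∏ d ∎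
    where
    A : Matrix (suc n)
    A i j = d j * δ (rotate i) j
    rearrange : ∀ s d e x → s * (d * e) * x ≡ e * (s * d * x)
    rearrange = solve-∀
    collect : ∀ s d p → s * d * p ≡ s * (p * d)
    collect = solve-∀

  -- Rows and columns undergo the same permutation, so its sign occurs twice; as matrices, P times
  -- its transpose is the identity.
  det-conjugate : ∀ {n} (A : Matrix n) (π : Fin n → Fin n) → (∀ {i j} → π i ≡ π j → i ≡ j) →
    det (λ i j → A (π i) (π j)) ≡ det A
  det-conjugate {n} A π π-injective = begin
    det (λ i j → A (π i) (π j))
      ≡⟨ sym (det-ext λ i k → trans
           (∑-δʳ (π k) λ j → (P ⊗ A) i j) (∑-δˡ (π i) λ j → A j (π k))) ⟩
    det (P ⊗ A ⊗ Pᵀ)            ≡⟨ trans (det-⊗ (P ⊗ A) Pᵀ) (cong (_* det Pᵀ) (det-⊗ P A)) ⟩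
    det P * det A * det Pᵀ      ≡⟨ rearrange (det P) (det A) (det Pᵀ) ⟩
    det P * det Pᵀ * det A      ≡⟨ cong (_* det A) P·Pᵀ ⟩
    1ℤ * det A                  ≡⟨ ℤ.*-identityˡ (det A) ⟩
    det A                       ∎
    where
    P Pᵀ : Matrix n
    P i j = δ (π i) j
    Pᵀ i j = δ i (π j)
    rearrange : ∀ p a q → p * a * q ≡ p * q * a
    rearrange = solve-∀
    δ-π : ∀ i j → δ (π i) (π j) ≡ δ i j
    δ-π i j with i Fin.≟ j
    ... | yes refl = trans (δ-diag (π i)) (sym (δ-diag i))
    ... | no  i≢j  = trans (δ-off (i≢j ∘ π-injective)) (sym (δ-off i≢j))
    P·Pᵀ : det P * det Pᵀ ≡ 1ℤ
    P·Pᵀ = trans (sym (det-⊗ P Pᵀ))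
      (trans (det-ext λ i k → trans (∑-δˡ (π i) λ j → δ j (π k)) (δ-π i k)) (det-δ {n}))

  -- Skew-symmetric determinants of even order are squares

  IsSkew : ∀ {n} → Matrix n → Set
  IsSkew A = ∀ i j → A i j ≡ - A j i

  skew-diagonal : ∀ {n} {A : Matrix n} → IsSkew A → ∀ i → A i i ≡ 0ℤ
  skew-diagonal {A = A} skew i = double-zero (trans (cong (λ x → A i i + x) (skew i i)) (ℤ.+-inverseʳ (A i i)))
    where
    twice : ∀ x → + 2 * x ≡ x + x
    twice = solve-∀
    double-zero : ∀ {x} → x + x ≡ 0ℤ → x ≡ 0ℤ
    double-zero {x} eq = ℤ.*-cancelˡ-≡ (+ 2) x 0ℤ (trans (twice x) eq)

  -- Clearing the first two columns below the pivot block (0 a / -a 0)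
  -- multiplies the determinant by a^n and leaves a smaller skew matrix.
  eliminate : ∀ {n} → Matrix (suc (suc n)) → Matrix n
  eliminate A i j =
    A (suc zero) (suc (suc i)) * A zero (suc (suc j)) +
    (- A zero (suc (suc i)) * A (suc zero) (suc (suc j)) +
     A zero (suc zero) * A (suc (suc i)) (suc (suc j)))

  eliminate-skew : ∀ {n} (A : Matrix (suc (suc n))) → IsSkew A → IsSkew (eliminate A)
  eliminate-skew A skew i j = trans
    (cong (λ x → A (suc zero) (suc (suc i)) * A zero (suc (suc j)) +
      (- A zero (suc (suc i)) * A (suc zero) (suc (suc j)) + A zero (suc zero) * x))
      (skew (suc (suc i)) (suc (suc j))))
    (algebra (A zero (suc zero)) (A zero (suc (suc i))) (A zero (suc (suc j)))
      (A (suc zero) (suc (suc i))) (A (suc zero) (suc (suc j))) (A (suc (suc j)) (suc (suc i))))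
    where
    algebra : ∀ a x y z w t →
      z * y + (- x * w + a * - t) ≡ - (w * x + (- y * z + a * t))
    algebra = solve-∀

  det-eliminate : ∀ {n} (A : Matrix (suc (suc n))) → IsSkew A →
    A zero (suc zero) ^ n * det A ≡
    A zero (suc zero) * A zero (suc zero) * det (eliminate A)
  det-eliminate {n} A skew = begin
    a ^ n * det A     ≡⟨ cong (_* det A) (sym det-E) ⟩
    det E * det A     ≡⟨ sym (det-⊗ E A) ⟩
    det (E ⊗ A)       ≡⟨ det-ext {A = E ⊗ A} {B = A zero ∷ (A (suc zero) ∷ L)} E⊗A ⟩
    det (A zero ∷ (A (suc zero) ∷ L))
      -- The corner entry is 0 by skew-symmetry. After the swap the diagonal starts with -a and a,
      -- with zeros below.
      ≡⟨ swap₀₁ (det-isAlternating {suc (suc n)}) (A zero) (A (suc zero)) L ⟩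
    - det B           ≡⟨ cong -_ det-B ⟩
    - (A (suc zero) zero * (a * det (eliminate A)))
      ≡⟨ cong (λ x → - (x * (a * det (eliminate A)))) (skew (suc zero) zero) ⟩
    - (- a * (a * det (eliminate A)))
      ≡⟨ signs a (det (eliminate A)) ⟩
    a * a * det (eliminate A) ∎
    where
    a = A zero (suc zero)
    signs : ∀ a d → - (- a * (a * d)) ≡ a * a * d
    signs = solve-∀

    -- Each later row is scaled by `a` and corrected by multiples of rows 0 and 1, chosen so that
    -- skew-symmetry cancels its first two entries. `E` is lower triangular with diagonal 1, 1, a,
    -- ..., a.
    E : Matrix (suc (suc n))
    E zero          j             = δ zero j
    E (suc zero)    j             = δ (suc zero) j
    E (suc (suc i)) zero          = A (suc zero) (suc (suc i))
    E (suc (suc i)) (suc zero)    = - A zero (suc (suc i))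
    E (suc (suc i)) (suc (suc j)) = a * δ i j

    det-E : det E ≡ a ^ n
    det-E = trans (det-row₀ {A = E} λ j → refl) (trans (ℤ.*-identityˡ _)
      (trans (det-row₀ {A = λ i j → E (suc i) (suc j)} λ j → refl) (trans (ℤ.*-identityˡ _)
      (trans (det-diagonal {n} λ _ → a) (∏-const n a)))))

    L : Fin n → Row (suc (suc n))
    L i zero          = 0ℤ
    L i (suc zero)    = 0ℤ
    L i (suc (suc j)) = eliminate A i j

    B : Matrix (suc (suc n))
    B = A (suc zero) ∷ (A zero ∷ L)

    det-B : det B ≡ A (suc zero) zero * (a * det (eliminate A))
    det-B = trans
      (det-column₀ {A = B} λ { zero → skew-diagonal skew zero ; (suc i) → refl })
      (cong (A (suc zero) zero *_) (det-column₀ {A = λ i j → B (suc i) (suc j)} λ i → refl))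

    row : ∀ i j → (E ⊗ A) (suc (suc i)) j ≡
      A (suc zero) (suc (suc i)) * A zero j +
      (- A zero (suc (suc i)) * A (suc zero) j + a * A (suc (suc i)) j)
    row i j = cong
      (λ x → A (suc zero) (suc (suc i)) * A zero j + (- A zero (suc (suc i)) * A (suc zero) j + x))
      (trans (sum-cong-≗ λ l → ℤ.*-assoc a (δ i l) (A (suc (suc l)) j))
        (trans (sym (*-distribˡ-sum a (λ l → δ i l * A (suc (suc l)) j)))
          (cong (a *_) (∑-δˡ i (λ l → A (suc (suc l)) j)))))

    E⊗A : ∀ i j → (E ⊗ A) i j ≡ (A zero ∷ (A (suc zero) ∷ L)) i j
    E⊗A zero       j = ∑-δˡ zero λ l → A l j
    E⊗A (suc zero) j = ∑-δˡ (suc zero) λ l → A l j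
    E⊗A (suc (suc i)) zero = trans (row i zero) (trans
      (cong₂ (λ u v → A (suc zero) (suc (suc i)) * u + v)
        (skew-diagonal skew zero)
        (cong₂ (λ u v → - A zero (suc (suc i)) * u + a * v)
          (skew (suc zero) zero) (skew (suc (suc i)) zero)))
      (cancel a (A (suc zero) (suc (suc i))) (A zero (suc (suc i)))))
      where
      cancel : ∀ a x y → x * 0ℤ + (- y * - a + a * - y) ≡ 0ℤ
      cancel = solve-∀
    E⊗A (suc (suc i)) (suc zero) = trans (row i (suc zero)) (trans
      (cong₂ (λ u v → A (suc zero) (suc (suc i)) * a + (- A zero (suc (suc i)) * u + a * v))
        (skew-diagonal skew (suc zero)) (skew (suc (suc i)) (suc zero)))
      (cancel a (A (suc zero) (suc (suc i))) (A zero (suc (suc i)))))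
      where
      cancel : ∀ a x y → x * a + (- y * 0ℤ + a * - x) ≡ 0ℤ
      cancel = solve-∀
    E⊗A (suc (suc i)) (suc (suc j)) = row i (suc (suc j))

  -- The index order 0, p + 1, and then all others brings entry (0, p + 1) to the pivot position (0,
  -- 1).
  pivot-injective : ∀ {n} (p : Fin (suc n)) {i j : Fin (suc (suc n))} →
    (zero ∷ (suc p ∷ (suc ∘ punchIn p))) i ≡ (zero ∷ (suc p ∷ (suc ∘ punchIn p))) j → i ≡ j
  pivot-injective p {zero}        {zero}        _  = refl
  pivot-injective p {zero}        {suc zero}    ()
  pivot-injective p {zero}        {suc (suc j)} ()
  pivot-injective p {suc zero}    {zero}        ()
  pivot-injective p {suc zero}    {suc zero}    _  = refl
  pivot-injective p {suc zero}    {suc (suc j)} eq =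
    contradiction (sym (Fin.suc-injective eq)) (Fin.punchInᵢ≢i p j)
  pivot-injective p {suc (suc i)} {zero}        ()
  pivot-injective p {suc (suc i)} {suc zero}    eq =
    contradiction (Fin.suc-injective eq) (Fin.punchInᵢ≢i p i)
  pivot-injective p {suc (suc i)} {suc (suc j)} eq =
    cong (λ l → suc (suc l)) (Fin.punchIn-injective p i j (Fin.suc-injective eq))

  -- Elimination divides by pivots; carrying the denominator `c` keeps the induction inside the
  -- integers. Either row 0 vanishes and the determinant with it, or a simultaneous permutation of
  -- rows and columns supplies a pivot.
  skew-rational-square : ∀ k (A : Matrix (k ℕ.* 2)) → IsSkew A →
    ∃₂ λ c s → c ≢ 0ℤ × c * c * det A ≡ s * s
  skew-rational-square zero    A skew = 1ℤ , 1ℤ , (λ ()) , refl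
  skew-rational-square (suc k) A skew with Fin.any? (λ j → ¬? (A zero j ℤ.≟ 0ℤ))
  ... | no  A₀≡0 = 1ℤ , 0ℤ , (λ ()) , trans (ℤ.*-identityˡ (det A))
    (IsMultilinear.zero-row det-isMultilinear {A} zero
      λ j → decidable-stable (A zero j ℤ.≟ 0ℤ) λ A₀j≢0 → A₀≡0 (j , A₀j≢0))
  ... | yes (zero  , A₀₀≢0) = contradiction (skew-diagonal {A = A} skew zero) A₀₀≢0
  ... | yes (suc p , a≢0)   =
    let c , s , c≢0 , c²D≡s² = skew-rational-square k (eliminate B) (eliminate-skew B B-skew)
    in c * a ^ k , a * s , nonzero c≢0 , (begin
      c * a ^ k * (c * a ^ k) * det A    ≡⟨ cong (c * a ^ k * (c * a ^ k) *_)
                                            (sym (det-conjugate A π (pivot-injective p))) ⟩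
      c * a ^ k * (c * a ^ k) * det B    ≡⟨ regroup c (a ^ k) (det B) ⟩
      -- The block left after the pivot has even order, so the factor lost in the elimination is
      -- itself a square.
      c * c * (a ^ k * a ^ k * det B)    ≡⟨ cong (λ x → c * c * (x * det B)) (square-power a k) ⟩
      c * c * (a ^ (k ℕ.* 2) * det B)    ≡⟨ cong (c * c *_) (det-eliminate B B-skew) ⟩
      c * c * (a * a * det (eliminate B)) ≡⟨ regroup′ c a (det (eliminate B)) ⟩
      a * a * (c * c * det (eliminate B)) ≡⟨ cong (a * a *_) c²D≡s² ⟩
      a * a * (s * s)                    ≡⟨ regroup″ a s ⟩
      a * s * (a * s)                    ∎)
    where
    π : Fin (suc k ℕ.* 2) → Fin (suc k ℕ.* 2)
    π = zero ∷ (suc p ∷ (suc ∘ punchIn p))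
    B : Matrix (suc k ℕ.* 2)
    B i j = A (π i) (π j)
    B-skew : IsSkew B
    B-skew i j = skew (π i) (π j)
    a = A zero (suc p)
    nonzero : ∀ {c} → c ≢ 0ℤ → c * a ^ k ≢ 0ℤ
    nonzero {c} c≢0 eq with ℤ.i*j≡0⇒i≡0∨j≡0 c eq
    ... | inj₁ c≡0  = c≢0 c≡0
    ... | inj₂ aᵏ≡0 = a≢0 (ℤ.i^n≡0⇒i≡0 a k aᵏ≡0)
    square-power : ∀ a k → a ^ k * a ^ k ≡ a ^ (k ℕ.* 2)
    square-power a k = trans (sym (ℤ.^-distribˡ-+-* a k k))
      (cong (a ^_) (trans (cong (k ℕ.+_) (sym (ℕ.+-identityʳ k))) (ℕ.*-comm 2 k)))
    regroup : ∀ c b d → c * b * (c * b) * d ≡ c * c * (b * b * d)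
    regroup = solve-∀
    regroup′ : ∀ c a d → c * c * (a * a * d) ≡ a * a * (c * c * d)
    regroup′ = solve-∀
    regroup″ : ∀ a s → a * a * (s * s) ≡ a * s * (a * s)
    regroup″ = solve-∀

  -- After division by the gcd, m′ is coprime to n′ and divides n′ · n′, hence divides n′, hence is
  -- 1. So m is the gcd.
  m²∣n²⇒m∣n : ∀ m n → m ≢ 0 → m ℕ.* m ℕ.∣ n ℕ.* n → m ℕ.∣ n
  m²∣n²⇒m∣n m n m≢0 m²∣n² = subst (ℕ._∣ n) g≡m (gcd[m,n]∣n m n)
    where
    g = gcd m n
    instance
      g≢0 : ℕ.NonZero g
      g≢0 = ℕ.≢-nonZero (m≢0 ∘ gcd[m,n]≡0⇒m≡0)
      g²≢0 : ℕ.NonZero (g ℕ.* g)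
      g²≢0 = ℕ.m*n≢0 g g
    m′ = m ℕ./ g
    n′ = n ℕ./ g
    m≡ : m ≡ m′ ℕ.* g
    m≡ = sym (ℕ.m/n*n≡m (gcd[m,n]∣m m n))
    n≡ : n ≡ n′ ℕ.* g
    n≡ = sym (ℕ.m/n*n≡m (gcd[m,n]∣n m n))
    coprime : Coprime m′ n′
    coprime = coprime-/gcd m n
    m′²∣n′² : m′ ℕ.* m′ ℕ.∣ n′ ℕ.* n′
    m′²∣n′² = ℕ.*-cancelʳ-∣ (g ℕ.* g) (subst₂ ℕ._∣_
      (trans (cong₂ ℕ._*_ m≡ m≡) (ℕ.[m*n]*[o*p]≡[m*o]*[n*p] m′ g m′ g))
      (trans (cong₂ ℕ._*_ n≡ n≡) (ℕ.[m*n]*[o*p]≡[m*o]*[n*p] n′ g n′ g)) m²∣n²)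
    m′≡1 : m′ ≡ 1
    m′≡1 = coprime (ℕ.∣-refl , coprime-divisor coprime (ℕ.∣-trans (ℕ.m∣m*n m′) m′²∣n′²))
    g≡m : g ≡ m
    g≡m = sym (trans m≡ (trans (cong (ℕ._* g) m′≡1) (ℕ.*-identityˡ g)))

  rational-square⇒square : ∀ c s d → c ≢ 0ℤ → c * c * d ≡ s * s → ∃ λ t → t ^ 2 ≡ d
  rational-square⇒square c s d c≢0 c²d≡s² with ∣ᵤ⇒∣ {c} {s}
    (m²∣n²⇒m∣n ∣ c ∣ ∣ s ∣ (c≢0 ∘ ℤ.∣i∣≡0⇒i≡0)
      (ℕ.divides ∣ d ∣ (begin
        ∣ s ∣ ℕ.* ∣ s ∣          ≡⟨ sym (ℤ.abs-* s s) ⟩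
        ∣ s * s ∣                ≡⟨ cong ∣_∣ (trans (sym c²d≡s²) (ℤ.*-comm (c * c) d)) ⟩
        ∣ d * (c * c) ∣          ≡⟨ trans (ℤ.abs-* d (c * c)) (cong (∣ d ∣ ℕ.*_) (ℤ.abs-* c c)) ⟩
        ∣ d ∣ ℕ.* (∣ c ∣ ℕ.* ∣ c ∣) ∎)))
  ... | divides q s≡qc = q , sym (ℤ.*-cancelˡ-≡ (c * c) d (q ^ 2) (begin
      c * c * d       ≡⟨ trans c²d≡s² (cong₂ _*_ s≡qc s≡qc) ⟩
      q * c * (q * c) ≡⟨ regroup q c ⟩
      c * c * q ^ 2   ∎))
    where
    instance
      c-nonZero : ℤ.NonZero c
      c-nonZero = ℤ.≢-nonZero c≢0
      c²-nonZero : ℤ.NonZero (c * c)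
      c²-nonZero = ℤ.i*j≢0 c c
    regroup : ∀ q c → q * c * (q * c) ≡ c * c * (q * (q * 1ℤ))
    regroup = solve-∀

  skew-det-square : ∀ k (A : Matrix (k ℕ.* 2)) → IsSkew A → ∃ λ t → t ^ 2 ≡ det A
  skew-det-square k A skew =
    let c , s , c≢0 , c²D≡s² = skew-rational-square k A skew
    in rational-square⇒square c s (det A) c≢0 c²D≡s²

open Determinant
open import Data.Nat.Combinatorics using (_C_; nC1≡n; nCn≡1; nCk≡nC[n∸k]; nCk≡n!/k![n-k]!; k![n∸k]!∣n!)
open import Data.Vec.Base as Vec using (Vec; []; _∷_)

-- Reindexing of sums and products, and arithmetic modulo p

module _ {a ℓ} (M : CommutativeMonoid a ℓ) where
  open CommutativeMonoid M using (Carrier; _≈_; ∙-congˡ; reflexive)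
  open import Algebra.Properties.CommutativeMonoid.Sum M using ()
    renaming (sum to fold; sum-remove to fold-remove; sum-cong-≗ to fold-cong)

  -- No inverse of `π` is constructed: deleting `π zero` from the target leaves an injection of the
  -- smaller index set into itself. The general monoid serves sums and products at once.
  fold-injective : ∀ {n} (g : Fin n → Carrier) {π : Fin n → Fin n} →
    (∀ {i j} → π i ≡ π j → i ≡ j) → fold (g ∘ π) ≈ fold g
  fold-injective {zero}  g π-inj = CommutativeMonoid.refl M
  fold-injective {suc n} g {π} π-inj = CommutativeMonoid.trans M
    (∙-congˡ (CommutativeMonoid.trans M
      (reflexive (fold-cong λ i → cong g (sym (Fin.punchIn-punchOut (π₀≢ i)))))
      (fold-injective (g ∘ punchIn (π zero)) {λ i → punchOut (π₀≢ i)} λ {i} {j} eq →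
        Fin.suc-injective (π-inj (Fin.punchOut-injective (π₀≢ i) (π₀≢ j) eq)))))
    (CommutativeMonoid.sym M (fold-remove g))
    where
    π₀≢ : ∀ i → π zero ≢ π (suc i)
    π₀≢ i eq with () ← π-inj eq

∑-injective : ∀ {n} (g : Fin n → ℤ) (π : Fin n → Fin n) →
  (∀ {i j} → π i ≡ π j → i ≡ j) → sum (g ∘ π) ≡ sum g
∑-injective g π = fold-injective ℤ.+-0-commutativeMonoid g {π}

∏-injective : ∀ {n} (g : Fin n → ℤ) (π : Fin n → Fin n) →
  (∀ {i j} → π i ≡ π j → i ≡ j) → ∏ (g ∘ π) ≡ ∏ g
∏-injective g π = fold-injective ℤ.*-1-commutativeMonoid g {π}

-- Wrapping the congruence in a record lets Agda infer its two sides.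
record Cong (p : ℕ) (a b : ℤ) : Set where
  constructor wrap
  field unwrap : a ≡ b [mod p ]

module Modular (p : ℕ) where
  open Cong public

  infix 4 _≈_ _≉_ _≈?_
  _≈_ _≉_ : ℤ → ℤ → Set
  _≈_ = Cong p
  a ≉ b = ¬ (a ≈ b)

  private
    difference : ∀ {a b} x → x ≡ a - b → + p ∣ x → a ≈ b
    difference x refl p∣x = wrap p∣x

  ≈-reflexive : ∀ {a b} → a ≡ b → a ≈ b
  ≈-reflexive {a} refl = wrap (divides 0ℤ (trans (ℤ.+-inverseʳ a) (sym (ℤ.*-zeroˡ (+ p)))))

  ≈-refl : ∀ {a} → a ≈ a
  ≈-refl = ≈-reflexive refl

  ≈-sym : ∀ {a b} → a ≈ b → b ≈ a
  ≈-sym {a} {b} (wrap d) = difference _ (flip a b) (∣m⇒∣-m d)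
    where
    flip : ∀ a b → - (a - b) ≡ b - a
    flip = solve-∀

  ≈-trans : ∀ {a b c} → a ≈ b → b ≈ c → a ≈ c
  ≈-trans {a} {b} {c} (wrap d) (wrap e) = difference _ (chain a b c) (∣m∣n⇒∣m+n d e)
    where
    chain : ∀ a b c → (a - b) + (b - c) ≡ a - c
    chain = solve-∀

  ≈-setoid : Setoid _ _
  ≈-setoid = record
    { Carrier = ℤ ; _≈_ = _≈_
    ; isEquivalence = record { refl = ≈-refl ; sym = ≈-sym ; trans = ≈-trans } }

  _≈?_ : ∀ a b → Dec (a ≈ b)
  a ≈? b = map′ wrap unwrap (+ p ∣? a - b)

  +-cong : ∀ {a b c d} → a ≈ b → c ≈ d → a + c ≈ b + d
  +-cong {a} {b} {c} {d} (wrap e) (wrap f) = difference _ (split a b c d) (∣m∣n⇒∣m+n e f)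
    where
    split : ∀ a b c d → (a - b) + (c - d) ≡ (a + c) - (b + d)
    split = solve-∀

  *-cong : ∀ {a b c d} → a ≈ b → c ≈ d → a * c ≈ b * d
  *-cong {a} {b} {c} {d} (wrap e) (wrap f) =
    difference _ (split a b c d) (∣m∣n⇒∣m+n (∣n⇒∣m*n c e) (∣n⇒∣m*n b f))
    where
    split : ∀ a b c d → c * (a - b) + b * (c - d) ≡ a * c - b * d
    split = solve-∀

  *-congˡ : ∀ {a b} c → a ≈ b → c * a ≈ c * b
  *-congˡ c = *-cong (≈-refl {c})

  *-congʳ : ∀ {a b} c → a ≈ b → a * c ≈ b * c
  *-congʳ c a≈b = *-cong a≈b (≈-refl {c})

  +-congˡ : ∀ {a b} c → a ≈ b → c + a ≈ c + b
  +-congˡ c = +-cong (≈-refl {c})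

  neg-cong : ∀ {a b} → a ≈ b → - a ≈ - b
  neg-cong {a} {b} (wrap d) = difference _ (negate a b) (∣m⇒∣-m d)
    where
    negate : ∀ a b → - (a - b) ≡ - a - - b
    negate = solve-∀

  ^-cong : ∀ {a b} n → a ≈ b → a ^ n ≈ b ^ n
  ^-cong zero    a≈b = ≈-refl
  ^-cong (suc n) a≈b = *-cong a≈b (^-cong n a≈b)

  ∑-cong : ∀ {n} {f g : Fin n → ℤ} → (∀ i → f i ≈ g i) → sum f ≈ sum g
  ∑-cong {zero}  f≈g = ≈-refl
  ∑-cong {suc n} f≈g = +-cong (f≈g zero) (∑-cong (f≈g ∘ suc))

  ∏-cong : ∀ {n} {f g : Fin n → ℤ} → (∀ i → f i ≈ g i) → ∏ f ≈ ∏ g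
  ∏-cong {zero}  f≈g = ≈-refl
  ∏-cong {suc n} f≈g = *-cong (f≈g zero) (∏-cong (f≈g ∘ suc))

  det-cong : ∀ {n} {A B : Matrix n} → (∀ i j → A i j ≈ B i j) → det A ≈ det B
  det-cong {zero}  A≈B = ≈-refl
  det-cong {suc n} A≈B = ∑-cong λ j →
    *-cong (*-congˡ (-1ℤ ^ toℕ j) (A≈B zero j)) (det-cong λ i k → A≈B (suc i) (punchIn j k))

  ≈0⇒∣ : ∀ {a} → a ≈ 0ℤ → + p ∣ a
  ≈0⇒∣ {a} (wrap d) = subst (+ p ∣_) (ℤ.+-identityʳ a) d

  ∣⇒≈0 : ∀ {a} → + p ∣ a → a ≈ 0ℤ
  ∣⇒≈0 {a} = difference a (sym (ℤ.+-identityʳ a))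

  p≈0 : + p ≈ 0ℤ
  p≈0 = ∣⇒≈0 (divides 1ℤ (sym (ℤ.*-identityˡ (+ p))))

  a-b≈0⇒a≈b : ∀ {a b} → a - b ≈ 0ℤ → a ≈ b
  a-b≈0⇒a≈b = wrap ∘ ≈0⇒∣

  a≈b⇒a-b≈0 : ∀ {a b} → a ≈ b → a - b ≈ 0ℤ
  a≈b⇒a-b≈0 = ∣⇒≈0 ∘ unwrap

  square⇒IsSquareMod : .{{_ : ℕ.NonZero p}} → ∀ x {a} → x * x ≈ a → IsSquareMod p a
  square⇒IsSquareMod x {a} x²≈a = r , unwrap (≈-trans (≈-trans
    (≈-reflexive (cong (+ toℕ r *_) (ℤ.*-identityʳ (+ toℕ r)))) (*-cong r≈x r≈x)) x²≈a)
    where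
    r : Fin p
    r = fromℕ< (ℤ.n%ℕd<d x p)
    r≈x : + toℕ r ≈ x
    r≈x = difference _ (begin
      - (x ℤ./ℕ p) * + p                                      ≡⟨ cancel (+ (x ℤ.%ℕ p)) (x ℤ./ℕ p) (+ p) ⟩
      + (x ℤ.%ℕ p) - (+ (x ℤ.%ℕ p) + (x ℤ./ℕ p) * + p)
        ≡⟨ cong₂ (λ u v → + u - v) (sym (Fin.toℕ-fromℕ< (ℤ.n%ℕd<d x p))) (sym (ℤ.a≡a%ℕn+[a/ℕn]*n x p)) ⟩
      + toℕ r - x ∎) (divides (- (x ℤ./ℕ p)) refl)
      where
      open ≡-Reasoning
      cancel : ∀ r q p → - q * p ≡ r - (r + q * p)
      cancel = solve-∀

-- Polynomials and their roots modulo a prime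

-- A vector of length d stands for the monic polynomial of degree d with these lower coefficients,
-- constant term first. The implicit leading 1 fixes the degree modulo every p.
horner : ∀ {d} → Vec ℤ d → ℤ → ℤ
horner []       x = 1ℤ
horner (c ∷ cs) x = x * horner cs x + c

-- The quotient in synthetic division by x - r.
deflate : ∀ {d} → Vec ℤ (suc d) → ℤ → Vec ℤ d
deflate (c ∷ [])      r = []
deflate (c ∷ c′ ∷ cs) r = horner (c′ ∷ cs) r ∷ deflate (c′ ∷ cs) r

horner-deflate : ∀ {d} (cs : Vec ℤ (suc d)) r x →
  horner cs x ≡ (x - r) * horner (deflate cs r) x + horner cs r
horner-deflate (c ∷ []) r x = linear c r x
  where
  linear : ∀ c r x → x * 1ℤ + c ≡ (x - r) * 1ℤ + (r * 1ℤ + c)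
  linear = solve-∀
horner-deflate (c ∷ c′ ∷ cs) r x = trans
  (cong (λ h → x * h + c) (horner-deflate (c′ ∷ cs) r x))
  (algebra x r c (horner (deflate (c′ ∷ cs) r) x) (horner (c′ ∷ cs) r))
  where
  algebra : ∀ x r c q h → x * ((x - r) * q + h) + c ≡ (x - r) * (x * q + h) + (r * h + c)
  algebra = solve-∀

horner-replicate-0 : ∀ n x → horner (Vec.replicate n 0ℤ) x ≡ x ^ n
horner-replicate-0 zero    x = refl
horner-replicate-0 (suc n) x = trans (ℤ.+-identityʳ _) (cong (x *_) (horner-replicate-0 n x))

module ModularPrime (p : ℕ) (p-prime : Prime p) where
  open Modular p public

  instance
    p-nonZero : ℕ.NonZero p
    p-nonZero = prime⇒nonZero p-prime

  1≉0 : 1ℤ ≉ 0ℤ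
  1≉0 1≈0 = ℕ.nonTrivial⇒≢1 {{prime⇒nonTrivial p-prime}} (ℕ.∣1⇒≡1 (∣⇒∣ᵤ (≈0⇒∣ 1≈0)))

  integral : ∀ a b → a * b ≈ 0ℤ → a ≈ 0ℤ ⊎ b ≈ 0ℤ
  integral a b ab≈0 with euclidsLemma ∣ a ∣ ∣ b ∣ p-prime
    (subst (p ℕ.∣_) (ℤ.abs-* a b) (∣⇒∣ᵤ (≈0⇒∣ ab≈0)))
  ... | inj₁ p∣a = inj₁ (∣⇒≈0 (∣ᵤ⇒∣ p∣a))
  ... | inj₂ p∣b = inj₂ (∣⇒≈0 (∣ᵤ⇒∣ p∣b))

  *-unit : ∀ {a b} → a ≉ 0ℤ → b ≉ 0ℤ → a * b ≉ 0ℤ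
  *-unit {a} {b} a≉0 b≉0 ab≈0 with integral a b ab≈0
  ... | inj₁ a≈0 = a≉0 a≈0
  ... | inj₂ b≈0 = b≉0 b≈0

  unit-cancel : ∀ {a b} → a ≉ 0ℤ → a * b ≈ 0ℤ → b ≈ 0ℤ
  unit-cancel {a} {b} a≉0 ab≈0 with integral a b ab≈0
  ... | inj₁ a≈0 = contradiction a≈0 a≉0
  ... | inj₂ b≈0 = b≈0

  *-cancelˡ : ∀ {a b c} → a ≉ 0ℤ → a * b ≈ a * c → b ≈ c
  *-cancelˡ {a} {b} {c} a≉0 ab≈ac = a-b≈0⇒a≈b (unit-cancel a≉0
    (≈-trans (≈-reflexive (distrib a b c)) (a≈b⇒a-b≈0 ab≈ac)))
    where
    distrib : ∀ a b c → a * (b - c) ≡ a * b - a * c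
    distrib = solve-∀

  ∏-unit : ∀ {n} {f : Fin n → ℤ} → (∀ i → f i ≉ 0ℤ) → ∏ f ≉ 0ℤ
  ∏-unit {zero}  f≉0 = 1≉0
  ∏-unit {suc n} f≉0 = *-unit (f≉0 zero) (∏-unit (f≉0 ∘ suc))

  -- Dividing by x - r₀ leaves a monic quotient of smaller degree. It vanishes at the other points,
  -- since their differences from r₀ are units.
  lagrange : ∀ {d} (cs : Vec ℤ d) (r : Fin (suc d) → ℤ) →
    (∀ {i j} → r i ≈ r j → i ≡ j) → (∀ i → horner cs (r i) ≈ 0ℤ) → ⊥
  lagrange []       r r-distinct root = 1≉0 (root zero)
  lagrange cs@(_ ∷ _) r r-distinct root =
    lagrange (deflate cs (r zero)) (r ∘ suc) (Fin.suc-injective ∘ r-distinct) quotient-root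
    where
    quotient-root : ∀ i → horner (deflate cs (r zero)) (r (suc i)) ≈ 0ℤ
    quotient-root i = unit-cancel
      (λ r-r₀≈0 → Fin.0≢1+n (sym (r-distinct (a-b≈0⇒a≈b r-r₀≈0))))
      (≈-trans (≈-reflexive (solve-left (horner-deflate cs (r zero) (r (suc i)))))
        (a≈b⇒a-b≈0 (≈-trans (root (suc i)) (≈-sym (root zero)))))
      where
      cancel : ∀ x y → x ≡ (x + y) - y
      cancel = solve-∀
      solve-left : ∀ {x y z} → z ≡ x + y → x ≡ z - y
      solve-left {x} {y} refl = cancel x y

  -- Applied to x^d - 1. The search makes the conclusion positive, because the vanishing of power
  -- sums needs an actual element whose power is not 1.
  roots-of-unity : ∀ d .{{_ : ℕ.NonZero d}} (r : Fin (suc d) → ℤ) →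
    (∀ {i j} → r i ≈ r j → i ≡ j) → ∃ λ i → r i ^ d ≉ 1ℤ
  roots-of-unity (suc d) r r-distinct with Fin.any? (λ i → ¬? (r i ^ suc d ≈? 1ℤ))
  ... | yes found = found
  ... | no  none  = ⊥-elim (lagrange (-1ℤ ∷ Vec.replicate d 0ℤ) r r-distinct λ i →
    ≈-trans (≈-reflexive (cong (λ x → r i * x - 1ℤ) (horner-replicate-0 d (r i))))
      (a≈b⇒a-b≈0 (decidable-stable (r i ^ suc d ≈? 1ℤ) λ r≉1 → none (i , r≉1))))

-- Identities for powers, binomial coefficients and products

^-distribʳ-* : ∀ a b n → (a * b) ^ n ≡ a ^ n * b ^ n
^-distribʳ-* a b zero    = refl
^-distribʳ-* a b (suc n) =
  trans (cong (a * b *_) (^-distribʳ-* a b n)) (interchange a b (a ^ n) (b ^ n))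
  where
  interchange : ∀ a b x y → a * b * (x * y) ≡ a * x * (b * y)
  interchange = solve-∀

^-comm-exponents : ∀ a m n → (a ^ m) ^ n ≡ (a ^ n) ^ m
^-comm-exponents a m n = trans (ℤ.^-*-assoc a m n)
  (trans (cong (a ^_) (ℕ.*-comm m n)) (sym (ℤ.^-*-assoc a n m)))

^-double : ∀ a n → a ^ (n ℕ.* 2) ≡ (a * a) ^ n
^-double a n = trans (sym (ℤ.^-*-assoc a n 2)) (trans (^-comm-exponents a n 2)
  (cong (λ x → (a * x) ^ n) (ℤ.*-identityʳ a)))

-1^even : ∀ n → -1ℤ ^ (n ℕ.* 2) ≡ 1ℤ
-1^even n = trans (^-double -1ℤ n) (ℤ.^-zeroˡ n)

∏-*const : ∀ {n} c (f : Fin n → ℤ) → ∏ (λ i → c * f i) ≡ c ^ n * ∏ f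
∏-*const {zero}  c f = refl
∏-*const {suc n} c f = trans (cong (c * f zero *_) (∏-*const c (f ∘ suc)))
  (interchange c (f zero) (c ^ n) (∏ (f ∘ suc)))
  where
  interchange : ∀ a b x y → a * b * (x * y) ≡ a * x * (b * y)
  interchange = solve-∀

Exp-^ : ∀ x n → x Exp.^ n ≡ x ^ n
Exp-^ x zero    = refl
Exp-^ x (suc n) = cong (x *_) (Exp-^ x n)

Mult-* : ∀ n x → n Mult.× x ≡ + n * x
Mult-* zero    x = sym (ℤ.*-zeroˡ x)
Mult-* (suc n) x = trans (cong (λ y → x + y) (Mult-* n x)) (sym (trans
  (ℤ.*-distribʳ-+ x 1ℤ (+ n)) (cong (_+ + n * x) (ℤ.*-identityˡ x))))

-- With n = m the middle exponents of y are m, ..., 1, one in each class modulo m, so orthogonality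
-- selects exactly one middle term. The two ends repeat classes and are kept apart.
binomial-split : ∀ x y n → (x + y) ^ suc n ≡
  y ^ suc n + (∑[ r < n ] (+ (suc n C suc (toℕ r)) * (x ^ suc (toℕ r) * y ^ (n ℕ.∸ toℕ r))) + x ^ suc n)
binomial-split x y n = begin
  (x + y) ^ suc n         ≡⟨ sym (Exp-^ (x + y) (suc n)) ⟩
  (x + y) Exp.^ suc n     ≡⟨ Binomial.theorem (suc n) x y ⟩
  ∑[ r < suc (suc n) ] Binomial.binomialTerm x y (suc n) r
    ≡⟨ sum-cong-≗ {suc (suc n)} (λ r → term (suc n) (toℕ r)) ⟩
  t 0 + ∑[ r < suc n ] t (suc (toℕ r))
    ≡⟨ cong (λ z → t 0 + z) (sum-init-last {n} (λ r → t (suc (toℕ r)))) ⟩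
  t 0 + (∑[ r < n ] t (suc (toℕ (inject₁ r))) + t (suc (toℕ (fromℕ n))))
    ≡⟨ cong₂ _+_ first (cong₂ _+_
         (sum-cong-≗ {n} λ r → cong (t ∘ suc) (Fin.toℕ-inject₁ r))
         (trans (cong (t ∘ suc) (Fin.toℕ-fromℕ n)) last)) ⟩
  y ^ suc n + (∑[ r < n ] t (suc (toℕ r)) + x ^ suc n) ∎
  where
  open ≡-Reasoning
  t : ℕ → ℤ
  t r = + (suc n C r) * (x ^ r * y ^ (suc n ℕ.∸ r))
  term : ∀ n r → (n C r) Mult.× (x Exp.^ r * y Exp.^ (n ℕ.∸ r)) ≡ + (n C r) * (x ^ r * y ^ (n ℕ.∸ r))
  term n r = trans (Mult-* (n C r) _)
    (cong (+ (n C r) *_) (cong₂ _*_ (Exp-^ x r) (Exp-^ y (n ℕ.∸ r))))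
  first : t 0 ≡ y ^ suc n
  first = trans (cong (λ c → + c * (1ℤ * y ^ suc n)) (nC0 (suc n)))
    (trans (ℤ.*-identityˡ _) (ℤ.*-identityˡ _))
    where
    nC0 : ∀ n → n C 0 ≡ 1
    nC0 n = trans (nCk≡nC[n∸k] {0} {n} ℕ.z≤n) (nCn≡1 n)
  last : t (suc n) ≡ x ^ suc n
  last = trans (cong₂ (λ c e → + c * (x ^ suc n * y ^ e)) (nCn≡1 (suc n)) (ℕ.n∸n≡0 (suc n)))
    (trans (ℤ.*-identityˡ _) (ℤ.*-identityʳ _))

-- Products over natural numbers can be reversed, paired and cut at a bound without casts between
-- `Fin` types.
∏< : ℕ → (ℕ → ℤ) → ℤ
∏< zero    f = 1ℤ
∏< (suc n) f = ∏< n f * f n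

∏-toℕ : ∀ n f → ∏ {n} (f ∘ toℕ) ≡ ∏< n f
∏-toℕ zero    f = refl
∏-toℕ (suc n) f = trans (∏-init-last {n} (f ∘ toℕ)) (cong₂ _*_
  (trans (∏-cong-≗ {n} (cong f ∘ Fin.toℕ-inject₁)) (∏-toℕ n f)) (cong f (Fin.toℕ-fromℕ n)))

∏<-first : ∀ n f → ∏< (suc n) f ≡ f 0 * ∏< n (f ∘ suc)
∏<-first zero    f = trans (ℤ.*-identityˡ (f 0)) (sym (ℤ.*-identityʳ (f 0)))
∏<-first (suc n) f = trans (cong (_* f (suc n)) (∏<-first n f)) (ℤ.*-assoc (f 0) _ _)

∏<-cong : ∀ n {f g} → (∀ i → i ℕ.< n → f i ≡ g i) → ∏< n f ≡ ∏< n g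
∏<-cong zero    f≡g = refl
∏<-cong (suc n) f≡g = cong₂ _*_
  (∏<-cong n λ i i<n → f≡g i (ℕ.m≤n⇒m≤1+n i<n)) (f≡g n (ℕ.n<1+n n))

∏<-* : ∀ n f g → ∏< n (λ i → f i * g i) ≡ ∏< n f * ∏< n g
∏<-* zero    f g = refl
∏<-* (suc n) f g = trans (cong (_* (f n * g n)) (∏<-* n f g))
  (interchange (∏< n f) (∏< n g) (f n) (g n))
  where
  interchange : ∀ a b c d → a * b * (c * d) ≡ a * c * (b * d)
  interchange = solve-∀

∏<-const : ∀ n c → ∏< n (λ _ → c) ≡ c ^ n
∏<-const zero    c = refl
∏<-const (suc n) c = trans (cong (_* c) (∏<-const n c)) (ℤ.*-comm (c ^ n) c)

-- Among the exponents 1, ..., 2k exactly k are odd.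
∏<-signs : ∀ k → ∏< (k ℕ.* 2) (λ e → -1ℤ ^ suc e) ≡ -1ℤ ^ k
∏<-signs zero    = refl
∏<-signs (suc k) = trans
  (cong₂ (λ x s → x * (-1ℤ * s) * (-1ℤ * (-1ℤ * s))) (∏<-signs k) (-1^even k))
  (ℤ.*-comm (-1ℤ ^ k * (-1ℤ * 1ℤ)) 1ℤ ∙ ℤ.*-identityˡ _ ∙ ℤ.*-comm (-1ℤ ^ k) -1ℤ)
  where
  _∙_ = trans
  infixl 5 _∙_

-1^-self-inverse : ∀ n → -1ℤ ^ n * -1ℤ ^ n ≡ 1ℤ
-1^-self-inverse n = trans (sym (^-distribʳ-* -1ℤ -1ℤ n)) (ℤ.^-zeroˡ n)

-1^-complement : ∀ {m e} → e ℕ.≤ m → -1ℤ ^ m ≡ 1ℤ → -1ℤ ^ (m ℕ.∸ e) ≡ -1ℤ ^ e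
-1^-complement {m} {e} e≤m even = begin
  -1ℤ ^ (m ℕ.∸ e)                           ≡⟨ sym (ℤ.*-identityʳ _) ⟩
  -1ℤ ^ (m ℕ.∸ e) * 1ℤ                      ≡⟨ cong (-1ℤ ^ (m ℕ.∸ e) *_) (sym (-1^-self-inverse e)) ⟩
  -1ℤ ^ (m ℕ.∸ e) * (-1ℤ ^ e * -1ℤ ^ e)     ≡⟨ sym (ℤ.*-assoc (-1ℤ ^ (m ℕ.∸ e)) (-1ℤ ^ e) (-1ℤ ^ e)) ⟩
  -1ℤ ^ (m ℕ.∸ e) * -1ℤ ^ e * -1ℤ ^ e       ≡⟨ cong (_* -1ℤ ^ e) (sym (ℤ.^-distribˡ-+-* -1ℤ (m ℕ.∸ e) e)) ⟩
  -1ℤ ^ (m ℕ.∸ e ℕ.+ e) * -1ℤ ^ e           ≡⟨ cong (λ n → -1ℤ ^ n * -1ℤ ^ e) (ℕ.m∸n+n≡m e≤m) ⟩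
  -1ℤ ^ m * -1ℤ ^ e                         ≡⟨ cong (_* -1ℤ ^ e) even ⟩
  1ℤ * -1ℤ ^ e                              ≡⟨ ℤ.*-identityˡ _ ⟩
  -1ℤ ^ e ∎
  where open ≡-Reasoning

factorial-suc : ∀ n → + (suc n !) ≡ + suc n * + (n !)
factorial-suc n = ℤ.pos-* (suc n) (n !)

∏<-factorial : ∀ n → ∏< n (λ e → + suc e) ≡ + (n !)
∏<-factorial zero    = refl
∏<-factorial (suc n) = trans (cong (_* + suc n) (∏<-factorial n))
  (trans (ℤ.*-comm (+ (n !)) (+ suc n)) (sym (factorial-suc n)))

∏<-reverse : ∀ n f → ∏< n (λ i → f (n ℕ.∸ suc i)) ≡ ∏< n f
∏<-reverse zero    f = refl
∏<-reverse (suc n) f = trans (∏<-first n (λ i → f (n ℕ.∸ i)))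
  (trans (cong (f n *_) (∏<-reverse n f)) (ℤ.*-comm (f n) (∏< n f)))

∏<-even : ∀ n f → ∏< (n ℕ.* 2) f ≡ ∏< n (λ i → f (i ℕ.* 2) * f (suc (i ℕ.* 2)))
∏<-even zero    f = refl
∏<-even (suc n) f = trans (cong (λ x → x * f (n ℕ.* 2) * f (suc (n ℕ.* 2))) (∏<-even n f))
  (ℤ.*-assoc (∏< n (λ i → f (i ℕ.* 2) * f (suc (i ℕ.* 2)))) (f (n ℕ.* 2)) (f (suc (n ℕ.* 2))))

binomial-factorials : ∀ {n r} → r ℕ.≤ n → + (n C r) * (+ (r !) * + ((n ℕ.∸ r) !)) ≡ + (n !)
binomial-factorials {n} {r} r≤n = begin
  + (n C r) * (+ (r !) * + ((n ℕ.∸ r) !))  ≡⟨ cong (+ (n C r) *_) (sym (ℤ.pos-* (r !) ((n ℕ.∸ r) !))) ⟩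
  + (n C r) * + (r ! ℕ.* (n ℕ.∸ r) !)      ≡⟨ sym (ℤ.pos-* (n C r) _) ⟩
  + ((n C r) ℕ.* (r ! ℕ.* (n ℕ.∸ r) !))      ≡⟨ cong (λ c → + (c ℕ.* (r ! ℕ.* (n ℕ.∸ r) !))) (nCk≡n!/k![n-k]! r≤n) ⟩
  + ((n ! ℕ./ (r ! ℕ.* (n ℕ.∸ r) !)) ℕ.* (r ! ℕ.* (n ℕ.∸ r) !))
    ≡⟨ cong +_ (ℕ.m/n*n≡m (k![n∸k]!∣n! r≤n)) ⟩
  + (n !) ∎
  where
  open ≡-Reasoning
  instance _ = r ℕ.!* (n ℕ.∸ r) !≢0

-- The first product is 3 · 5 ⋯ (2n + 1); the other two factors together are 2 · 4 ⋯ (2n + 2).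
double-factorial : ∀ n → ∏< n (λ i → + suc (suc (suc (i ℕ.* 2)))) * (+ 2) ^ suc n * + (suc n !) ≡
  + ((suc n ℕ.* 2) !)
double-factorial zero    = refl
double-factorial (suc n) = begin
  D * + suc (N) * (+ 2 * T) * + (suc (suc n) !)
    ≡⟨ cong (D * + suc N * (+ 2 * T) *_) (factorial-suc (suc n)) ⟩
  D * + suc N * (+ 2 * T) * (+ suc (suc n) * F)
    ≡⟨ regroup D (+ suc N) T (+ suc (suc n)) F ⟩
  + suc (suc n) * + 2 * (+ suc N * (D * T * F))
    ≡⟨ cong₂ (λ x y → x * (+ suc N * y)) (sym (ℤ.pos-* (suc (suc n)) 2)) (double-factorial n) ⟩
  + suc (suc N) * (+ suc N * + (N !))
    ≡⟨ cong (+ suc (suc N) *_) (sym (factorial-suc N)) ⟩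
  + suc (suc N) * + (suc N !)
    ≡⟨ sym (factorial-suc (suc N)) ⟩
  + (suc (suc N) !) ∎
  where
  open ≡-Reasoning
  N = suc n ℕ.* 2
  D = ∏< n (λ i → + suc (suc (suc (i ℕ.* 2))))
  T = (+ 2) ^ suc n
  F = + (suc n !)
  regroup : ∀ d a t b f → d * a * (+ 2 * t) * (b * f) ≡ b * + 2 * (a * (d * t * f))
  regroup = solve-∀

-1^-cases : ∀ n → -1ℤ ^ n ≡ 1ℤ ⊎ -1ℤ ^ n ≡ -1ℤ
-1^-cases zero    = inj₁ refl
-1^-cases (suc n) with -1^-cases n
... | inj₁ eq = inj₂ (cong (-1ℤ *_) eq)
... | inj₂ eq = inj₁ (cong (-1ℤ *_) eq)

-1^-square : ∀ n → (-1ℤ ^ n) ^ n ≡ -1ℤ ^ n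
-1^-square n with -1^-cases n
... | inj₁ eq = trans (cong (_^ n) eq) (trans (ℤ.^-zeroˡ n) (sym eq))
... | inj₂ eq = cong (_^ n) eq

cube-minus-one : ∀ x → x ^ 3 - 1ℤ ≡ (x - 1ℤ) * (x * x + x + 1ℤ)
cube-minus-one = algebra
  where
  algebra : ∀ x → x * (x * (x * 1ℤ)) - 1ℤ ≡ (x - 1ℤ) * (x * x + x + 1ℤ)
  algebra = solve-∀

-- Legendre symbols as signs, and symbols modulo 3

legendre-residue : ∀ a p → IsQuadraticResidue p a → legendre a p ≡ 1ℤ
legendre-residue a p (p∤a , sq) = trans
  (cong (λ b → if b then 0ℤ else if does (isSquareMod? p a) then 1ℤ else -1ℤ) (dec-false (+ p ∣? a) p∤a))
  (cong (λ b → if b then 1ℤ else -1ℤ) (dec-true (isSquareMod? p a) sq))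

legendre-nonresidue : ∀ a p → ¬ (+ p ∣ a) → ¬ IsSquareMod p a → legendre a p ≡ -1ℤ
legendre-nonresidue a p p∤a ¬sq = trans
  (cong (λ b → if b then 0ℤ else if does (isSquareMod? p a) then 1ℤ else -1ℤ) (dec-false (+ p ∣? a) p∤a))
  (cong (λ b → if b then 1ℤ else -1ℤ) (dec-false (isSquareMod? p a) ¬sq))

-- These three values are pairwise incongruent modulo an odd prime, which is how congruences from
-- Euler's criterion become equalities of integers.
data IsSign : ℤ → Set where
  null  : IsSign 0ℤ
  plus  : IsSign 1ℤ
  minus : IsSign -1ℤ

IsSign-* : ∀ {a b} → IsSign a → IsSign b → IsSign (a * b)
IsSign-* null  b = null
IsSign-* plus  null = null
IsSign-* plus  plus = plus
IsSign-* plus  minus = minus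
IsSign-* minus null = null
IsSign-* minus plus = minus
IsSign-* minus minus = plus

legendre-isSign : ∀ a p → IsSign (legendre a p)
legendre-isSign a p = sign (does (+ p ∣? a)) (does (isSquareMod? p a))
  where
  sign : ∀ b c → IsSign (if b then 0ℤ else if c then 1ℤ else -1ℤ)
  sign true  _     = null
  sign false true  = plus
  sign false false = minus

-1^-isSign : ∀ n → IsSign (-1ℤ ^ n)
-1^-isSign n with -1^-cases n
... | inj₁ eq = subst IsSign (sym eq) plus
... | inj₂ eq = subst IsSign (sym eq) minus

∏<-trivial-tail : ∀ a b f → (∀ i → f (a ℕ.+ i) ≡ 1ℤ) → ∏< (a ℕ.+ b) f ≡ ∏< a f
∏<-trivial-tail a zero    f f≡1 = cong (λ n → ∏< n f) (ℕ.+-identityʳ a)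
∏<-trivial-tail a (suc b) f f≡1 = trans (cong (λ n → ∏< n f) (ℕ.+-suc a b))
  (trans (cong₂ _*_ (∏<-trivial-tail a b f f≡1) (f≡1 b)) (ℤ.*-identityʳ (∏< a f)))

∏<-^ : ∀ n f e → ∏< n (λ i → f i ^ e) ≡ ∏< n f ^ e
∏<-^ zero    f e = sym (ℤ.^-zeroˡ e)
∏<-^ (suc n) f e = trans (cong (_* f n ^ e) (∏<-^ n f e)) (sym (^-distribʳ-* (∏< n f) (f n) e))

-- As a product over r, the sign of the count can be compared factor by factor with the quadratic
-- characters of the r.
-1^-count : ∀ {P : ℕ → Set} (P? : ∀ r → Dec (P r)) n →
  -1ℤ ^ length (filter P? (upTo n)) ≡ ∏< n (λ r → if does (P? r) then -1ℤ else 1ℤ)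
-1^-count P? zero    = refl
-1^-count P? (suc n) = begin
  -1ℤ ^ length (filter P? (upTo (suc n)))
    ≡⟨ cong (λ xs → -1ℤ ^ length (filter P? xs)) (sym (List.upTo-∷ʳ n)) ⟩
  -1ℤ ^ length (filter P? (upTo n List.++ List.[ n ]))
    ≡⟨ cong (λ xs → -1ℤ ^ length xs) (List.filter-++ P? (upTo n) List.[ n ]) ⟩
  -1ℤ ^ length (filter P? (upTo n) List.++ filter P? List.[ n ])
    ≡⟨ cong (-1ℤ ^_) (List.length-++ (filter P? (upTo n))) ⟩
  -1ℤ ^ (length (filter P? (upTo n)) ℕ.+ length (filter P? List.[ n ]))
    ≡⟨ ℤ.^-distribˡ-+-* -1ℤ (length (filter P? (upTo n))) (length (filter P? List.[ n ])) ⟩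
  -1ℤ ^ length (filter P? (upTo n)) * -1ℤ ^ length (filter P? List.[ n ])
    ≡⟨ cong₂ _*_ (-1^-count P? n) single ⟩
  ∏< (suc n) (λ r → if does (P? r) then -1ℤ else 1ℤ) ∎
  where
  open ≡-Reasoning
  single : -1ℤ ^ length (filter P? List.[ n ]) ≡ (if does (P? n) then -1ℤ else 1ℤ)
  single with does (P? n)
  ... | true  = refl
  ... | false = refl

residue-mod-3 : ∀ n → ∃ λ t → n ≡ t ℕ.* 3 ⊎ n ≡ 1 ℕ.+ t ℕ.* 3 ⊎ n ≡ 2 ℕ.+ t ℕ.* 3
residue-mod-3 zero = 0 , inj₁ refl
residue-mod-3 (suc n) with residue-mod-3 n
... | t , inj₁ eq        = t , inj₂ (inj₁ (cong suc eq))
... | t , inj₂ (inj₁ eq) = t , inj₂ (inj₂ (cong suc eq))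
... | t , inj₂ (inj₂ eq) = suc t , inj₁ (cong suc eq)

module _ {n} c q (n≡ : n ≡ c ℕ.+ q ℕ.* 3) where
  open Modular 3

  ≈-remainder-3 : + n ≈ + c
  ≈-remainder-3 = wrap (divides (+ q) (trans (cong (λ x → + x - + c) n≡)
    (trans (cancel (+ c) (+ (q ℕ.* 3))) (ℤ.pos-* q 3))))
    where
    cancel : ∀ c x → c + x - c ≡ x
    cancel = solve-∀

  3∤ : .{{_ : ℕ.NonZero c}} → c ℕ.< 3 → ¬ (+ 3 ∣ + n)
  3∤ c<3 3∣n = ℕ.>⇒∤ c<3 (∣⇒∣ᵤ (≈0⇒∣ (≈-trans (≈-sym ≈-remainder-3) (∣⇒≈0 3∣n))))

legendre-1-mod-3 : ∀ {n} q → n ≡ 1 ℕ.+ q ℕ.* 3 → legendre (+ n) 3 ≡ 1ℤ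
legendre-1-mod-3 {n} q n≡ = legendre-residue (+ n) 3
  (3∤ 1 q n≡ (ℕ.s≤s (ℕ.s≤s ℕ.z≤n)) , suc zero , unwrap (≈-sym (≈-remainder-3 1 q n≡)))
  where open Modular 3

legendre-2-mod-3 : ∀ {n} q → n ≡ 2 ℕ.+ q ℕ.* 3 → legendre (+ n) 3 ≡ -1ℤ
legendre-2-mod-3 {n} q n≡ = legendre-nonresidue (+ n) 3 (3∤ 2 q n≡ (ℕ.s≤s (ℕ.s≤s (ℕ.s≤s ℕ.z≤n)))) nonsquare
  where
  open Modular 3
  2≢square : ∀ (x : Fin 3) → ¬ ((+ toℕ x) ^ 2 ≈ + 2)
  2≢square zero             (wrap 3∣2) = ℕ.>⇒∤ (ℕ.n<1+n 2) (∣⇒∣ᵤ 3∣2)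
  2≢square (suc zero)       (wrap 3∣1) = ℕ.>⇒∤ (ℕ.s≤s (ℕ.s≤s ℕ.z≤n)) (∣⇒∣ᵤ 3∣1)
  2≢square (suc (suc zero)) (wrap 3∣2) = ℕ.>⇒∤ (ℕ.n<1+n 2) (∣⇒∣ᵤ 3∣2)
  nonsquare : ¬ IsSquareMod 3 (+ n)
  nonsquare (x , x²≡n) = 2≢square x (≈-trans (wrap x²≡n) (≈-remainder-3 2 q n≡))

-- Quadratic residues and Euler's criterion

module Residues
  (p : ℕ) (p-prime : Prime p) (m k : ℕ) (p≡ : p ≡ suc (m ℕ.* 2)) (m≡ : m ≡ suc k ℕ.* 2)
  (α : Fin m → ℤ)
  (residue  : ∀ i → IsQuadraticResidue p (α i))
  (distinct : ∀ {i j} → α i ≡ α j [mod p ] → i ≡ j)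
  (complete : ∀ a → IsQuadraticResidue p a → ∃ λ i → α i ≡ a [mod p ])
  where

  open ModularPrime p p-prime
  open SetoidReasoning ≈-setoid

  instance
    m-nonZero : ℕ.NonZero m
    m-nonZero = subst ℕ.NonZero (sym m≡) _

  -- Here the root is any integer, so roots can be multiplied without reducing them modulo p as
  -- `IsSquareMod` would require.
  IsSquare : ℤ → Set
  IsSquare a = ∃ λ x → x * x ≈ a

  fromIsSquareMod : ∀ {a} → IsSquareMod p a → IsSquare a
  fromIsSquareMod (x , x²≈a) = + toℕ x , ≈-trans
    (≈-reflexive (cong (+ toℕ x *_) (sym (ℤ.*-identityʳ (+ toℕ x))))) (wrap x²≈a)

  2m≈-1 : + 2 * + m ≈ -1ℤ
  2m≈-1 = begin
    + 2 * + m                ≡⟨ ℤ.*-comm (+ 2) (+ m) ⟩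
    + m * + 2                ≡⟨ sym (ℤ.pos-* m 2) ⟩
    + (m ℕ.* 2)              ≡⟨ predecessor (+ (m ℕ.* 2)) ⟩
    + suc (m ℕ.* 2) - 1ℤ     ≡⟨ cong (λ n → + n - 1ℤ) (sym p≡) ⟩
    + p - 1ℤ                 ≈⟨ +-cong p≈0 (≈-refl { -1ℤ}) ⟩
    0ℤ - 1ℤ ∎
    where
    predecessor : ∀ x → x ≡ 1ℤ + x - 1ℤ
    predecessor = solve-∀

  α-unit : ∀ i → α i ≉ 0ℤ
  α-unit i αi≈0 = proj₁ (residue i) (≈0⇒∣ αi≈0)

  α-square : ∀ i → IsSquare (α i)
  α-square i = fromIsSquareMod (proj₂ (residue i))

  α-distinct : ∀ {i j} → α i ≈ α j → i ≡ j
  α-distinct = distinct ∘ unwrap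

  index : ∀ a → a ≉ 0ℤ → IsSquare a → ∃ λ i → α i ≈ a
  index a a≉0 (x , x²≈a) =
    let i , αi≡a = complete a ((a≉0 ∘ ∣⇒≈0) , square⇒IsSquareMod x x²≈a) in i , wrap αi≡a

  -- Multiplication by a residue permutes the residues. Comparing products yields `power`; comparing
  -- power sums yields `power-sum`, which forces a power sum to vanish once some b ^ e is not 1.
  module Multiply (b : ℤ) (b≉0 : b ≉ 0ℤ) (b-square : IsSquare b) where
    private
      product : ∀ i → ∃ λ j → α j ≈ b * α i
      product i = index (b * α i) (*-unit b≉0 (α-unit i)) (square b-square (α-square i))
        where
        interchange : ∀ x y → x * y * (x * y) ≡ (x * x) * (y * y)
        interchange = solve-∀
        square : IsSquare b → IsSquare (α i) → IsSquare (b * α i)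
        square (x , x²≈b) (y , y²≈α) =
          x * y , ≈-trans (≈-reflexive (interchange x y)) (*-cong x²≈b y²≈α)

    π : Fin m → Fin m
    π = proj₁ ∘ product

    α∘π : ∀ i → α (π i) ≈ b * α i
    α∘π = proj₂ ∘ product

    π-injective : ∀ {i j} → π i ≡ π j → i ≡ j
    π-injective {i} {j} eq = α-distinct (*-cancelˡ b≉0 (begin
      b * α i ≈⟨ ≈-sym (α∘π i) ⟩
      α (π i) ≡⟨ cong α eq ⟩
      α (π j) ≈⟨ α∘π j ⟩
      b * α j ∎))

    power : b ^ m ≈ 1ℤ
    power = *-cancelˡ {∏ α} (∏-unit α-unit) (begin
      ∏ α * b ^ m           ≡⟨ ℤ.*-comm (∏ α) (b ^ m) ⟩
      b ^ m * ∏ α           ≡⟨ sym (∏-*const b α) ⟩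
      ∏ (λ i → b * α i)     ≈⟨ ≈-sym (∏-cong α∘π) ⟩
      ∏ (α ∘ π)             ≡⟨ ∏-injective α π π-injective ⟩
      ∏ α                   ≡⟨ sym (ℤ.*-identityʳ (∏ α)) ⟩
      ∏ α * 1ℤ              ∎)

    power-sum : ∀ e → ∑[ i < m ] (α i ^ e) ≈ b ^ e * ∑[ i < m ] (α i ^ e)
    power-sum e = begin
      ∑[ i < m ] (α i ^ e)
        ≡⟨ sym (∑-injective (λ i → α i ^ e) π π-injective) ⟩
      ∑[ i < m ] (α (π i) ^ e)
        ≈⟨ ∑-cong (λ i → ^-cong e (α∘π i)) ⟩
      ∑[ i < m ] ((b * α i) ^ e)
        ≡⟨ sum-cong-≗ (λ i → ^-distribʳ-* b (α i) e) ⟩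
      ∑[ i < m ] (b ^ e * α i ^ e)
        ≡⟨ sym (*-distribˡ-sum (b ^ e) (λ i → α i ^ e)) ⟩
      b ^ e * ∑[ i < m ] (α i ^ e) ∎

  square-power : ∀ {b} → b ≉ 0ℤ → IsSquare b → b ^ m ≈ 1ℤ
  square-power b≉0 b-square = Multiply.power _ b≉0 b-square

  unit-power : ∀ {a} → a ≉ 0ℤ → a ^ m * a ^ m ≈ 1ℤ
  unit-power {a} a≉0 = ≈-trans (≈-reflexive (sym (^-distribʳ-* a a m)))
    (square-power (*-unit a≉0 a≉0) (a , ≈-refl))

  -- The square of a^m is 1, so a^m is 1 or -1. It is not 1: the m residues already exhaust the
  -- roots of x^m - 1.
  nonsquare-power : ∀ {a} → a ≉ 0ℤ → ¬ IsSquare a → a ^ m ≈ -1ℤ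
  nonsquare-power {a} a≉0 a-nonsquare = a-b≈0⇒a≈b (unit-cancel not-one (begin
    (a ^ m - 1ℤ) * (a ^ m - -1ℤ) ≡⟨ difference-of-squares (a ^ m) ⟩
    a ^ m * a ^ m - 1ℤ           ≈⟨ a≈b⇒a-b≈0 (unit-power a≉0) ⟩
    0ℤ ∎))
    where
    difference-of-squares : ∀ x → (x - 1ℤ) * (x - -1ℤ) ≡ x * x - 1ℤ
    difference-of-squares = solve-∀
    a,α : Fin (suc m) → ℤ
    a,α zero    = a
    a,α (suc i) = α i
    a,α-distinct : ∀ {i j} → a,α i ≈ a,α j → i ≡ j
    a,α-distinct {zero}  {zero}  _  = refl
    a,α-distinct {zero}  {suc j} eq = ⊥-elim (a-nonsquare
      (proj₁ (α-square j) , ≈-trans (proj₂ (α-square j)) (≈-sym eq)))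
    a,α-distinct {suc i} {zero}  eq = ⊥-elim (a-nonsquare
      (proj₁ (α-square i) , ≈-trans (proj₂ (α-square i)) eq))
    a,α-distinct {suc i} {suc j} eq = cong suc (α-distinct eq)
    not-one : a ^ m - 1ℤ ≉ 0ℤ
    not-one aᵐ≈1 with roots-of-unity m a,α a,α-distinct
    ... | zero  , r≉1 = r≉1 (a-b≈0⇒a≈b aᵐ≈1)
    ... | suc i , r≉1 = r≉1 (square-power (α-unit i) (α-square i))

  legendre≈ : ∀ a → legendre a p ≈ a ^ m
  legendre≈ a = decide (+ p ∣? a) (isSquareMod? p a)
    (λ p∣a → ≈-sym (≈-trans (^-cong m (∣⇒≈0 p∣a)) (≈-reflexive (zero-power m))))
    (λ p∤a sq → ≈-sym (square-power (p∤a ∘ ≈0⇒∣) (fromIsSquareMod sq)))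
    (λ p∤a ¬sq → ≈-sym (nonsquare-power (p∤a ∘ ≈0⇒∣)
      λ { (x , x²≈a) → ¬sq (square⇒IsSquareMod x x²≈a) }))
    where
    zero-power : ∀ n .{{_ : ℕ.NonZero n}} → 0ℤ ^ n ≡ 0ℤ
    zero-power (suc n) = refl
    decide : ∀ {P Q : Set} (P? : Dec P) (Q? : Dec Q) {z} →
      (P → 0ℤ ≈ z) → (¬ P → Q → 1ℤ ≈ z) → (¬ P → ¬ Q → -1ℤ ≈ z) →
      (if does P? then 0ℤ else if does Q? then 1ℤ else -1ℤ) ≈ z
    decide (yes P) _       x y z = x P
    decide (no ¬P) (yes Q) x y z = y ¬P Q
    decide (no ¬P) (no ¬Q) x y z = z ¬P ¬Q

  -- Power sums of the residues and their orthogonality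

  σ : ℕ → ℤ
  σ e = ∑[ i < m ] (α i ^ e)

  σ-0 : σ 0 ≡ + m
  σ-0 = ones m
    where
    ones : ∀ n → ∑[ i < n ] 1ℤ ≡ + n
    ones zero    = refl
    ones (suc n) = cong (λ x → 1ℤ + x) (ones n)

  σ-period : ∀ e → σ (m ℕ.+ e) ≈ σ e
  σ-period e = ∑-cong λ i → begin
    α i ^ (m ℕ.+ e)   ≡⟨ ℤ.^-distribˡ-+-* (α i) m e ⟩
    α i ^ m * α i ^ e ≈⟨ *-congʳ (α i ^ e) (square-power (α-unit i) (α-square i)) ⟩
    1ℤ * α i ^ e      ≡⟨ ℤ.*-identityˡ (α i ^ e) ⟩
    α i ^ e           ∎

  nontrivial-power : ∀ e → suc e ℕ.< m → ∃ λ i → α i ^ suc e ≉ 1ℤ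
  nontrivial-power e e<m = 
    -- The hypothesis says that the residues include e + 2 distinct ones, one more than the degree e
    -- + 1.
    let i , r≉1 = roots-of-unity (suc e) (λ i → α (inject≤ i e<m))
                    (Fin.inject≤-injective e<m e<m _ _ ∘ α-distinct)
    in inject≤ i e<m , r≉1

  σ-vanish : ∀ e → suc e ℕ.< m → σ (suc e) ≈ 0ℤ
  σ-vanish e e<m =
    let i , αᵉ≉1 = nontrivial-power e e<m
    in unit-cancel {1ℤ - α i ^ suc e} (λ eq → αᵉ≉1 (≈-sym (a-b≈0⇒a≈b eq))) (begin
    (1ℤ - α i ^ suc e) * σ (suc e)    ≡⟨ expand (α i ^ suc e) (σ (suc e)) ⟩
    σ (suc e) - α i ^ suc e * σ (suc e)
      ≈⟨ a≈b⇒a-b≈0 (Multiply.power-sum (α i) (α-unit i) (α-square i) (suc e)) ⟩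
    0ℤ ∎)
    where
    expand : ∀ x s → (1ℤ - x) * s ≡ s - x * s
    expand = solve-∀

  -- The exponent is j - i plus a full period, which keeps it natural. Power sums vanish modulo p
  -- unless the exponent is divisible by m, and here that means i = j.
  σ-orthogonal : ∀ (i j : Fin m) → σ (m ℕ.∸ toℕ i ℕ.+ toℕ j) ≈ + m * δ i j
  σ-orthogonal i j with ℕ.<-cmp (toℕ i) (toℕ j)
  ... | tri≈ _ i≡j _ = begin
    σ (m ℕ.∸ toℕ i ℕ.+ toℕ j) ≡⟨ cong (λ x → σ (m ℕ.∸ toℕ i ℕ.+ x)) (sym i≡j) ⟩
    σ (m ℕ.∸ toℕ i ℕ.+ toℕ i) ≡⟨ cong σ (trans (ℕ.m∸n+n≡m (ℕ.<⇒≤ (Fin.toℕ<n i))) (sym (ℕ.+-identityʳ m))) ⟩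
    σ (m ℕ.+ 0)               ≈⟨ σ-period 0 ⟩
    σ 0                       ≡⟨ trans σ-0 (sym (ℤ.*-identityʳ (+ m))) ⟩
    + m * 1ℤ                  ≡⟨ cong (+ m *_) (sym (trans (cong (λ l → δ l j) (Fin.toℕ-injective i≡j)) (δ-diag j))) ⟩
    + m * δ i j               ∎
  ... | tri< i<j i≢j _ = begin
    σ (m ℕ.∸ toℕ i ℕ.+ toℕ j) ≡⟨ cong σ exponent ⟩
    σ (m ℕ.+ suc d)           ≈⟨ σ-period (suc d) ⟩
    σ (suc d)                 ≈⟨ σ-vanish d (ℕ.≤-<-trans d+1≤j (Fin.toℕ<n j)) ⟩
    0ℤ                        ≡⟨ off-diagonal ⟩
    + m * δ i j               ∎
    where
    d = toℕ j ℕ.∸ suc (toℕ i)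
    suc-d : suc d ≡ toℕ j ℕ.∸ toℕ i
    suc-d = sym (ℕ.+-∸-assoc 1 i<j)
    d+1≤j : suc d ℕ.≤ toℕ j
    d+1≤j = subst (ℕ._≤ toℕ j) (sym suc-d) (ℕ.m∸n≤m (toℕ j) (toℕ i))
    exponent : m ℕ.∸ toℕ i ℕ.+ toℕ j ≡ m ℕ.+ suc d
    exponent = trans (cong (m ℕ.∸ toℕ i ℕ.+_) (sym (ℕ.m+[n∸m]≡n (ℕ.<⇒≤ i<j))))
      (trans (sym (ℕ.+-assoc (m ℕ.∸ toℕ i) (toℕ i) _))
        (cong₂ ℕ._+_ (ℕ.m∸n+n≡m (ℕ.<⇒≤ (Fin.toℕ<n i))) (sym suc-d)))
    off-diagonal : 0ℤ ≡ + m * δ i j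
    off-diagonal = sym (trans (cong (+ m *_) (δ-off (i≢j ∘ cong toℕ))) (ℤ.*-zeroʳ (+ m)))
  ... | tri> _ i≢j j<i = begin
    σ (m ℕ.∸ toℕ i ℕ.+ toℕ j) ≡⟨ cong σ exponent ⟩
    σ (suc e)                 ≈⟨ σ-vanish e bound ⟩
    0ℤ                        ≡⟨ off-diagonal ⟩
    + m * δ i j               ∎
    where
    e = m ℕ.∸ suc (toℕ i) ℕ.+ toℕ j
    exponent : m ℕ.∸ toℕ i ℕ.+ toℕ j ≡ suc e
    exponent = cong (ℕ._+ toℕ j) (ℕ.+-∸-assoc 1 (Fin.toℕ<n i))
    bound : suc e ℕ.< m
    bound = subst₂ ℕ._<_ exponent (ℕ.m∸n+n≡m (ℕ.<⇒≤ (Fin.toℕ<n i)))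
      (ℕ.+-monoʳ-< (m ℕ.∸ toℕ i) j<i)
    off-diagonal : 0ℤ ≡ + m * δ i j
    off-diagonal = sym (trans (cong (+ m *_) (δ-off (i≢j ∘ cong toℕ))) (ℤ.*-zeroʳ (+ m)))

  -1^m≡1 : -1ℤ ^ m ≡ 1ℤ
  -1^m≡1 = trans (cong (-1ℤ ^_) m≡) (-1^even (suc k))

  -- The case i = 0 is the wrap-around x^m = 1: it is met by j = m - 1.
  σ-rotate : ∀ (i j : Fin m) → σ (m ℕ.∸ toℕ i ℕ.+ suc (toℕ j)) ≈ + m * δ (rotate i) j
  σ-rotate i j = ≈-trans (shifted (toℕ-rotate i)) (σ-orthogonal (rotate i) j)
    where
    r = toℕ (rotate i)
    m∸r : m ℕ.∸ r ≡ suc (m ℕ.∸ suc r)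
    m∸r = ℕ.+-∸-assoc 1 (Fin.toℕ<n (rotate i))
    shifted : (toℕ i ≡ 0 × suc r ≡ m) ⊎ toℕ i ≡ suc r →
      σ (m ℕ.∸ toℕ i ℕ.+ suc (toℕ j)) ≈ σ (m ℕ.∸ r ℕ.+ toℕ j)
    shifted (inj₁ (i≡0 , r+1≡m)) = begin
      σ (m ℕ.∸ toℕ i ℕ.+ suc (toℕ j)) ≡⟨ cong (λ x → σ (m ℕ.∸ x ℕ.+ suc (toℕ j))) i≡0 ⟩
      σ (m ℕ.+ suc (toℕ j))           ≈⟨ σ-period (suc (toℕ j)) ⟩
      σ (1 ℕ.+ toℕ j)                 ≡⟨ cong (λ x → σ (x ℕ.+ toℕ j)) (sym one) ⟩
      σ (m ℕ.∸ r ℕ.+ toℕ j)           ∎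
      where
      one : m ℕ.∸ r ≡ 1
      one = trans (cong (ℕ._∸ r) (sym r+1≡m)) (ℕ.m+n∸n≡m 1 r)
    shifted (inj₂ i≡r+1) = ≈-reflexive (cong σ (trans
      (cong (λ x → m ℕ.∸ x ℕ.+ suc (toℕ j)) i≡r+1)
      (trans (ℕ.+-suc (m ℕ.∸ suc r) (toℕ j)) (cong (ℕ._+ toℕ j) (sym m∸r)))))

  -- V evaluates the monomials 1, x, …, x^(m-1) at the residues, and W is
  -- its inverse modulo p by orthogonality, because -2 inverts m.
  V W : Matrix m
  V i b = α i ^ toℕ b
  W a i = - + 2 * α i ^ (m ℕ.∸ toℕ a)

  -2m≈1 : ∀ x → - + 2 * (+ m * x) ≈ x
  -2m≈1 x = begin
    - + 2 * (+ m * x)   ≡⟨ regroup (+ m) x ⟩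
    - (+ 2 * + m) * x   ≈⟨ *-congʳ x (neg-cong 2m≈-1) ⟩
    - -1ℤ * x           ≡⟨ ℤ.*-identityˡ x ⟩
    x                   ∎
    where
    regroup : ∀ m x → - + 2 * (m * x) ≡ - (+ 2 * m) * x
    regroup = solve-∀

  W-power : ∀ (a : Fin m) c e →
    ∑[ i < m ] (W a i * (c * α i ^ e)) ≡ c * (- + 2 * σ (m ℕ.∸ toℕ a ℕ.+ e))
  W-power a c e = trans
    (sum-cong-≗ λ i → trans
      (regroup c (α i ^ (m ℕ.∸ toℕ a)) (α i ^ e))
      (cong (c * - + 2 *_) (sym (ℤ.^-distribˡ-+-* (α i) (m ℕ.∸ toℕ a) e))))
    (trans (sym (*-distribˡ-sum (c * - + 2) (λ i → α i ^ (m ℕ.∸ toℕ a ℕ.+ e))))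
      (ℤ.*-assoc c (- + 2) (σ (m ℕ.∸ toℕ a ℕ.+ e))))
    where
    regroup : ∀ c x y → - + 2 * x * (c * y) ≡ c * - + 2 * (x * y)
    regroup = solve-∀

  W⊗V : ∀ a b → (W ⊗ V) a b ≈ δ a b
  W⊗V a b = begin
    ∑[ i < m ] (W a i * α i ^ toℕ b)
      ≡⟨ sum-cong-≗ (λ i → cong (W a i *_) (sym (ℤ.*-identityˡ (α i ^ toℕ b)))) ⟩
    ∑[ i < m ] (W a i * (1ℤ * α i ^ toℕ b))       ≡⟨ W-power a 1ℤ (toℕ b) ⟩
    1ℤ * (- + 2 * σ (m ℕ.∸ toℕ a ℕ.+ toℕ b))      ≡⟨ ℤ.*-identityˡ _ ⟩
    - + 2 * σ (m ℕ.∸ toℕ a ℕ.+ toℕ b)             ≈⟨ *-congˡ (- + 2) (σ-orthogonal a b) ⟩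
    - + 2 * (+ m * δ a b)                         ≈⟨ -2m≈1 (δ a b) ⟩
    δ a b ∎

  -- If A sends the monomial x^b to d_b x^(b+1), then W A V is a weighted
  -- cyclic shift of even order.
  det-shifting : ∀ (A : Matrix m) (d : Fin m → ℤ) →
    (∀ i b → ∑[ j < m ] (A i j * α j ^ toℕ b) ≈ d b * α i ^ suc (toℕ b)) →
    det A ≈ - ∏ d
  det-shifting A d A⊗V = begin
    det A                            ≡⟨ sym (ℤ.*-identityˡ (det A)) ⟩
    1ℤ * det A                       ≈⟨ *-congʳ (det A) (≈-sym det-WV) ⟩
    det W * det V * det A            ≡⟨ regroup (det W) (det V) (det A) ⟩
    det W * (det A * det V)          ≡⟨ cong (det W *_) (sym (det-⊗ A V)) ⟩
    det W * det (A ⊗ V)              ≡⟨ sym (det-⊗ W (A ⊗ V)) ⟩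
    det (W ⊗ (A ⊗ V))                ≈⟨ det-cong W⊗A⊗V ⟩
    det (λ a b → d b * δ (rotate a) b) ≡⟨ det-shift d ⟩
    -1ℤ ^ ℕ.pred m * ∏ d             ≡⟨ cong (_* ∏ d) odd ⟩
    -1ℤ * ∏ d                        ≡⟨ ℤ.-1*i≡-i (∏ d) ⟩
    - ∏ d                            ∎
    where
    regroup : ∀ w v a → w * v * a ≡ w * (a * v)
    regroup = solve-∀
    odd : -1ℤ ^ ℕ.pred m ≡ -1ℤ
    odd = trans (cong (λ n → -1ℤ ^ ℕ.pred n) m≡) (cong (-1ℤ *_) (-1^even k))
    det-WV : det W * det V ≈ 1ℤ
    det-WV = begin
      det W * det V ≡⟨ sym (det-⊗ W V) ⟩
      det (W ⊗ V)   ≈⟨ det-cong W⊗V ⟩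
      det (δ {m})   ≡⟨ det-δ {m} ⟩
      1ℤ ∎
    W⊗A⊗V : ∀ a b → (W ⊗ (A ⊗ V)) a b ≈ d b * δ (rotate a) b
    W⊗A⊗V a b = begin
      ∑[ i < m ] (W a i * (A ⊗ V) i b)                   ≈⟨ ∑-cong (λ i → *-congˡ (W a i) (A⊗V i b)) ⟩
      ∑[ i < m ] (W a i * (d b * α i ^ suc (toℕ b)))     ≡⟨ W-power a (d b) (suc (toℕ b)) ⟩
      d b * (- + 2 * σ (m ℕ.∸ toℕ a ℕ.+ suc (toℕ b)))    ≈⟨ *-congˡ (d b) (*-congˡ (- + 2) (σ-rotate a b)) ⟩
      d b * (- + 2 * (+ m * δ (rotate a) b))             ≈⟨ *-congˡ (d b) (-2m≈1 (δ (rotate a) b)) ⟩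
      d b * δ (rotate a) b ∎

  ∏α≈-1 : ∏ α ≈ -1ℤ
  ∏α≈-1 = begin
    ∏ α                          ≡⟨ sym (det-diagonal α) ⟩
    det (λ i j → α j * δ i j)    ≈⟨ det-shifting (λ i j → α j * δ i j) (λ _ → 1ℤ) (λ i b → ≈-reflexive (trans
      (sum-cong-≗ λ j → regroup (α j) (δ i j) (α j ^ toℕ b))
      (trans (∑-δˡ i (λ j → α j ^ suc (toℕ b))) (sym (ℤ.*-identityˡ _))))) ⟩
    - ∏ {m} (λ _ → 1ℤ)           ≡⟨ cong -_ (trans (∏-const m 1ℤ) (ℤ.^-zeroˡ m)) ⟩
    -1ℤ ∎
    where
    regroup : ∀ x d y → x * d * y ≡ d * (x * y)
    regroup = solve-∀

  -- The weights of the cyclic shift for the exponent m + 1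

  -- This is m - 2, the number of weights between the two exceptional ones.
  N : ℕ
  N = k ℕ.* 2

  -- Either the power sum is 0, or e is 0 or m and the power of the residue is 1. This lets x^(e+1)
  -- be factored out of the end terms of the binomial expansion, uniformly in e.
  σ-absorb : ∀ i e → e ℕ.≤ m → α i ^ e * σ e ≈ σ e
  σ-absorb i zero    _   = ≈-reflexive (ℤ.*-identityˡ (σ 0))
  σ-absorb i (suc e) e<m = absorb (ℕ.m≤n⇒m<n∨m≡n e<m)
    where
    absorb : suc e ℕ.< m ⊎ suc e ≡ m → α i ^ suc e * σ (suc e) ≈ σ (suc e)
    absorb (inj₁ e+1<m) = begin
      α i ^ suc e * σ (suc e) ≈⟨ *-congˡ (α i ^ suc e) (σ-vanish e e+1<m) ⟩
      α i ^ suc e * 0ℤ        ≡⟨ ℤ.*-zeroʳ (α i ^ suc e) ⟩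
      0ℤ                      ≈⟨ ≈-sym (σ-vanish e e+1<m) ⟩
      σ (suc e)               ∎
    absorb (inj₂ e+1≡m) = begin
      α i ^ suc e * σ (suc e) ≡⟨ cong (λ n → α i ^ n * σ (suc e)) e+1≡m ⟩
      α i ^ m * σ (suc e)     ≈⟨ *-congʳ (σ (suc e)) (square-power (α-unit i) (α-square i)) ⟩
      1ℤ * σ (suc e)          ≡⟨ ℤ.*-identityˡ (σ (suc e)) ⟩
      σ (suc e)               ∎

  binom : ℕ → ℤ
  binom r = + (suc m C r)

  -- The summands stem from the middle term selected by orthogonality, from x^(m+1) and from
  -- (-y)^(m+1). For e < m the second is nonzero modulo p only at e = 0 and the third only at e = m
  -- - 1.
  weight : ℕ → ℤ
  weight e = + m * (binom (suc e) * -1ℤ ^ (m ℕ.∸ e)) + σ e - σ (suc e)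

  M : Matrix m
  M i j = (α i + -1ℤ * α j) ^ suc m

  M-monomial : ∀ i (b : Fin m) →
    ∑[ j < m ] (M i j * α j ^ toℕ b) ≈ weight (toℕ b) * α i ^ suc (toℕ b)
  M-monomial i b = begin
    ∑[ j < m ] (M i j * α j ^ e)                    ≡⟨ sum-cong-≗ expand ⟩
    ∑[ j < m ] (first j + (middle j + last j))
      ≡⟨ trans (∑-distrib-+ first (λ j → middle j + last j))
           (cong (λ z → sum first + z) (∑-distrib-+ middle last)) ⟩
    sum first + (sum middle + sum last)
      ≈⟨ +-cong first≈ (+-cong middle≈ last≈) ⟩
    - σ (suc e) + (+ m * (binom (suc e) * x ^ suc e * -1ℤ ^ (m ℕ.∸ e)) + x * σ e)
      ≈⟨ +-cong (neg-cong (≈-sym (σ-absorb i (suc e) (Fin.toℕ<n b))))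
           (+-congˡ (+ m * (binom (suc e) * x ^ suc e * -1ℤ ^ (m ℕ.∸ e))) (*-congˡ x (≈-sym (σ-absorb i e (ℕ.<⇒≤ (Fin.toℕ<n b)))))) ⟩
    - (x * x ^ e * σ (suc e)) +
      (+ m * (binom (suc e) * (x * x ^ e) * -1ℤ ^ (m ℕ.∸ e)) + x * (x ^ e * σ e))
      ≡⟨ collect (+ m) (binom (suc e)) x (x ^ e) (-1ℤ ^ (m ℕ.∸ e)) (σ e) (σ (suc e)) ⟩
    weight e * x ^ suc e ∎
    where
    x = α i
    e = toℕ b
    coeff : Fin m → ℤ
    coeff r = binom (suc (toℕ r)) * x ^ suc (toℕ r) * -1ℤ ^ (m ℕ.∸ toℕ r)
    first middle last : Fin m → ℤ
    first j  = -1ℤ ^ suc m * α j ^ (m ℕ.+ suc e)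
    middle j = ∑[ r < m ] (coeff r * α j ^ (m ℕ.∸ toℕ r ℕ.+ e))
    last j   = x ^ suc m * α j ^ e

    negated-power : ∀ y n → (-1ℤ * y) ^ n * y ^ e ≡ -1ℤ ^ n * y ^ (n ℕ.+ e)
    negated-power y n = trans (cong (_* y ^ e) (^-distribʳ-* -1ℤ y n))
      (trans (ℤ.*-assoc (-1ℤ ^ n) (y ^ n) (y ^ e))
        (cong (-1ℤ ^ n *_) (sym (ℤ.^-distribˡ-+-* y n e))))

    distrib₃ : ∀ a b c y → (a + (b + c)) * y ≡ a * y + (b * y + c * y)
    distrib₃ = solve-∀
    regroup : ∀ c u v y → c * (u * v) * y ≡ c * u * (v * y)
    regroup = solve-∀

    expand : ∀ j → M i j * α j ^ e ≡ first j + (middle j + last j)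
    expand j = trans (cong (_* y ^ e) (binomial-split x (-1ℤ * y) m))
      (trans (distrib₃ ((-1ℤ * y) ^ suc m) (sum terms) (x ^ suc m) (y ^ e))
        (cong₂ (λ u v → u + (v + last j))
          (trans (negated-power y (suc m))
            (cong (λ n → -1ℤ ^ suc m * y ^ n) (sym (ℕ.+-suc m e))))
          (trans (*-distribʳ-sum (y ^ e) terms) (sum-cong-≗ term))))
      where
      y = α j
      terms : Fin m → ℤ
      terms r = binom (suc (toℕ r)) * (x ^ suc (toℕ r) * (-1ℤ * y) ^ (m ℕ.∸ toℕ r))
      term : ∀ r → terms r * y ^ e ≡ coeff r * y ^ (m ℕ.∸ toℕ r ℕ.+ e)
      term r = trans
        (regroup (binom (suc (toℕ r))) (x ^ suc (toℕ r)) ((-1ℤ * y) ^ (m ℕ.∸ toℕ r)) (y ^ e))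
        (trans (cong (binom (suc (toℕ r)) * x ^ suc (toℕ r) *_) (negated-power y (m ℕ.∸ toℕ r)))
          (sym (ℤ.*-assoc (binom (suc (toℕ r)) * x ^ suc (toℕ r)) (-1ℤ ^ (m ℕ.∸ toℕ r)) _)))

    first≈ : sum first ≈ - σ (suc e)
    first≈ = begin
      sum first                              ≡⟨ sym (*-distribˡ-sum (-1ℤ ^ suc m) (λ j → α j ^ (m ℕ.+ suc e))) ⟩
      -1ℤ ^ suc m * σ (m ℕ.+ suc e)          ≡⟨ cong (λ s → -1ℤ * s * σ (m ℕ.+ suc e)) -1^m≡1 ⟩
      -1ℤ * σ (m ℕ.+ suc e)                  ≈⟨ *-congˡ -1ℤ (σ-period (suc e)) ⟩
      -1ℤ * σ (suc e)                        ≡⟨ ℤ.-1*i≡-i (σ (suc e)) ⟩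
      - σ (suc e)                            ∎

    middle≈ : sum middle ≈ + m * coeff b
    middle≈ = begin
      ∑[ j < m ] ∑[ r < m ] (coeff r * α j ^ (m ℕ.∸ toℕ r ℕ.+ e))
        ≡⟨ ∑-comm (λ j r → coeff r * α j ^ (m ℕ.∸ toℕ r ℕ.+ e)) ⟩
      ∑[ r < m ] ∑[ j < m ] (coeff r * α j ^ (m ℕ.∸ toℕ r ℕ.+ e))
        ≡⟨ sum-cong-≗ (λ r → sym (*-distribˡ-sum (coeff r) (λ j → α j ^ (m ℕ.∸ toℕ r ℕ.+ e)))) ⟩
      ∑[ r < m ] (coeff r * σ (m ℕ.∸ toℕ r ℕ.+ e))
        ≈⟨ ∑-cong (λ r → *-congˡ (coeff r) (σ-orthogonal r b)) ⟩
      ∑[ r < m ] (coeff r * (+ m * δ r b))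
        ≡⟨ sum-cong-≗ (λ r → pull (coeff r) (+ m) (δ r b)) ⟩
      ∑[ r < m ] (+ m * coeff r * δ r b)
        ≡⟨ ∑-δʳ b (λ r → + m * coeff r) ⟩
      + m * coeff b ∎
      where
      pull : ∀ c m d → c * (m * d) ≡ m * c * d
      pull = solve-∀

    last≈ : sum last ≈ x * σ e
    last≈ = begin
      sum last          ≡⟨ sym (*-distribˡ-sum (x ^ suc m) (λ j → α j ^ e)) ⟩
      x * x ^ m * σ e   ≈⟨ *-congʳ (σ e) (*-congˡ x (square-power (α-unit i) (α-square i))) ⟩
      x * 1ℤ * σ e      ≡⟨ cong (_* σ e) (ℤ.*-identityʳ x) ⟩
      x * σ e           ∎

    collect : ∀ m c x y s t u → - (x * y * u) + (m * (c * (x * y) * s) + x * (y * t)) ≡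
      (m * (c * s) + t - u) * (x * y)
    collect = solve-∀

  weight-first : weight 0 ≈ + m * + suc (suc m)
  weight-first = begin
    + m * (binom 1 * -1ℤ ^ m) + σ 0 - σ 1
      ≈⟨ +-cong (≈-reflexive (cong₂ _+_
           (cong₂ (λ c s → + m * (+ c * s)) (nC1≡n (suc m)) -1^m≡1) σ-0))
           (neg-cong (σ-vanish 0 1<m)) ⟩
    + m * (+ suc m * 1ℤ) + + m - 0ℤ ≡⟨ collect (+ m) ⟩
    + m * + suc (suc m) ∎
    where
    1<m : 1 ℕ.< m
    1<m = subst (1 ℕ.<_) (sym m≡) (ℕ.s≤s (ℕ.s≤s ℕ.z≤n))
    collect : ∀ x → x * ((1ℤ + x) * 1ℤ) + x - 0ℤ ≡ x * (+ 2 + x)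
    collect = solve-∀

  -- Since C(m + 1, m) = m + 1 comes with the sign -1, this is the negative of the first weight. The
  -- exceptional pair thus contributes minus a square, and m + 2 survives only as (m + 2)^(2K) = (m
  -- + 2)^m.
  weight-last : weight (suc N) ≈ - (+ m * + suc (suc m))
  weight-last = begin
    + m * (binom (suc (suc N)) * -1ℤ ^ (m ℕ.∸ suc N)) + σ (suc N) - σ (suc (suc N))
      ≡⟨ cong₂ (λ n e → + m * (binom n * -1ℤ ^ e) + σ (suc N) - σ n) (sym m≡) m∸[N+1]≡1 ⟩
    + m * (binom m * -1ℤ) + σ (suc N) - σ m
      ≈⟨ +-cong (+-cong (≈-reflexive (cong (λ c → + m * (+ c * -1ℤ)) [m+1]Cm)) (σ-vanish N N+1<m)) (neg-cong σ-m) ⟩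
    + m * (+ suc m * -1ℤ) + 0ℤ - + m ≡⟨ collect (+ m) ⟩
    - (+ m * + suc (suc m)) ∎
    where
    N+1<m : suc N ℕ.< m
    N+1<m = subst (suc N ℕ.<_) (sym m≡) (ℕ.n<1+n (suc N))
    m∸[N+1]≡1 : m ℕ.∸ suc N ≡ 1
    m∸[N+1]≡1 = trans (cong (ℕ._∸ suc N) m≡) (ℕ.m+n∸n≡m 1 (suc N))
    [m+1]Cm : suc m C m ≡ suc m
    [m+1]Cm = trans (nCk≡nC[n∸k] (ℕ.n≤1+n m))
      (trans (cong (suc m C_) (ℕ.m+n∸n≡m 1 m)) (nC1≡n (suc m)))
    σ-m : σ m ≈ + m
    σ-m = begin
      σ m         ≡⟨ cong σ (sym (ℕ.+-identityʳ m)) ⟩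
      σ (m ℕ.+ 0) ≈⟨ σ-period 0 ⟩
      σ 0         ≡⟨ σ-0 ⟩
      + m         ∎
    collect : ∀ x → x * ((1ℤ + x) * -1ℤ) + 0ℤ - x ≡ - (x * (+ 2 + x))
    collect = solve-∀

  weight-middle : ∀ e → e ℕ.< N → weight (suc e) ≈ + m * (binom (suc (suc e)) * -1ℤ ^ suc e)
  weight-middle e e<N = begin
    + m * (binom (suc (suc e)) * -1ℤ ^ (m ℕ.∸ suc e)) + σ (suc e) - σ (suc (suc e))
      ≈⟨ +-cong (+-cong (≈-reflexive (cong (λ s → + m * (binom (suc (suc e)) * s))
            (-1^-complement (ℕ.<⇒≤ e+1<m) -1^m≡1)))
           (σ-vanish e e+1<m)) (neg-cong (σ-vanish (suc e) e+2<m)) ⟩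
    + m * (binom (suc (suc e)) * -1ℤ ^ suc e) + 0ℤ - 0ℤ ≡⟨ drop _ ⟩
    + m * (binom (suc (suc e)) * -1ℤ ^ suc e) ∎
    where
    e+2<m : suc (suc e) ℕ.< m
    e+2<m = subst (suc (suc e) ℕ.<_) (sym m≡) (ℕ.s≤s (ℕ.s≤s e<N))
    e+1<m : suc e ℕ.< m
    e+1<m = ℕ.<-trans (ℕ.n<1+n (suc e)) e+2<m
    drop : ∀ x → x + 0ℤ - 0ℤ ≡ x
    drop = solve-∀

  ∏<-≈ : ∀ n {f g} → (∀ i → i ℕ.< n → f i ≈ g i) → ∏< n f ≈ ∏< n g
  ∏<-≈ zero    f≈g = ≈-refl
  ∏<-≈ (suc n) {f} {g} f≈g = *-cong {∏< n f} {∏< n g} {f n} {g n}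
    (∏<-≈ n {f} {g} λ i i<n → f≈g i (ℕ.m≤n⇒m≤1+n i<n)) (f≈g n (ℕ.n<1+n n))

  Q : ℤ
  Q = ∏< N (λ e → binom (suc (suc e)))

  det-M : det M ≈ + suc (suc m) * + suc (suc m) * ((+ m) ^ m * (-1ℤ ^ k * Q))
  det-M = begin
    det M                       ≈⟨ det-shifting M (weight ∘ toℕ) M-monomial ⟩
    - ∏ {m} (weight ∘ toℕ)          ≡⟨ cong -_ (trans (∏-toℕ m weight) (cong (λ n → ∏< n weight) m≡)) ⟩
    - (∏< (suc N) weight * weight (suc N))
      ≡⟨ cong (λ z → - (z * weight (suc N))) (∏<-first N weight) ⟩
    - (weight 0 * ∏< N (weight ∘ suc) * weight (suc N))
      ≈⟨ neg-cong (*-cong (*-cong weight-first middle) weight-last) ⟩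
    - (+ m * + suc (suc m) * ((+ m) ^ N * (Q * -1ℤ ^ k)) * - (+ m * + suc (suc m)))
      ≡⟨ collect (+ m) (+ suc (suc m)) ((+ m) ^ N) (-1ℤ ^ k) Q ⟩
    + suc (suc m) * + suc (suc m) * ((+ m) ^ suc (suc N) * (-1ℤ ^ k * Q))
      ≡⟨ cong (λ n → + suc (suc m) * + suc (suc m) * ((+ m) ^ n * (-1ℤ ^ k * Q))) (sym m≡) ⟩
    + suc (suc m) * + suc (suc m) * ((+ m) ^ m * (-1ℤ ^ k * Q)) ∎
    where
    middle : ∏< N (weight ∘ suc) ≈ (+ m) ^ N * (Q * -1ℤ ^ k)
    middle = begin
      ∏< N (weight ∘ suc) ≈⟨ ∏<-≈ N weight-middle ⟩
      ∏< N (λ e → + m * (binom (suc (suc e)) * -1ℤ ^ suc e))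
        ≡⟨ ∏<-* N (λ _ → + m) (λ e → binom (suc (suc e)) * -1ℤ ^ suc e) ⟩
      ∏< N (λ _ → + m) * ∏< N (λ e → binom (suc (suc e)) * -1ℤ ^ suc e)
        ≡⟨ cong₂ _*_ (∏<-const N (+ m)) (trans
             (∏<-* N (λ e → binom (suc (suc e))) (λ e → -1ℤ ^ suc e)) (cong (Q *_) (∏<-signs k))) ⟩
      (+ m) ^ N * (Q * -1ℤ ^ k) ∎
    collect : ∀ m n y s q → - (m * n * (y * (q * s)) * - (m * n)) ≡ n * n * (m * (m * y) * (s * q))
    collect = solve-∀

  -- Quadratic characters of the constants

  K : ℕ
  K = suc k

  -- The Legendre symbol in the form of Euler's criterion; multiplicativity is then an identity
  -- between integers.
  χ : ℤ → ℤ
  χ a = a ^ m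

  χ-* : ∀ a b → χ (a * b) ≡ χ a * χ b
  χ-* a b = ^-distribʳ-* a b m

  χ-squared : ∀ {a} → a ≉ 0ℤ → χ (a * a) ≈ 1ℤ
  χ-squared {a} a≉0 = square-power (*-unit a≉0 a≉0) (a , ≈-refl)

  -- Since m is even, the character of a number can be read off from its square: this evaluates
  -- `χ z` from z² = -1, and `χ s` from the determinant.
  χ≡squareᴷ : ∀ a → χ a ≡ (a * a) ^ K
  χ≡squareᴷ a = trans (cong (a ^_) m≡) (^-double a K)

  inverse-sign : ∀ {x y} → x * y ≈ 1ℤ → y * y ≈ 1ℤ → x ≈ y
  inverse-sign {x} {y} xy≈1 y²≈1 = begin
    x            ≡⟨ sym (ℤ.*-identityʳ x) ⟩
    x * 1ℤ       ≈⟨ *-congˡ x (≈-sym y²≈1) ⟩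
    x * (y * y)  ≡⟨ sym (ℤ.*-assoc x y y) ⟩
    x * y * y    ≈⟨ *-congʳ y xy≈1 ⟩
    1ℤ * y       ≡⟨ ℤ.*-identityˡ y ⟩
    y            ∎

  small-unit : ∀ {n} .{{_ : ℕ.NonZero n}} → n ℕ.< p → + n ≉ 0ℤ
  small-unit n<p n≈0 = ℕ.>⇒∤ n<p (∣⇒∣ᵤ (≈0⇒∣ n≈0))

  small-injective-≤ : ∀ {a b} → a ℕ.≤ b → b ℕ.< p → + a ≈ + b → a ≡ b
  small-injective-≤ {a} {b} a≤b b<p a≈b = ℕ.≤-antisym a≤b (ℕ.≮⇒≥ λ a<b →
    small-unit {b ℕ.∸ a} {{ℕ.>-nonZero (ℕ.m<n⇒0<n∸m a<b)}} (ℕ.≤-<-trans (ℕ.m∸n≤m b a) b<p) (begin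
      + (b ℕ.∸ a)    ≡⟨ cancel (+ a) (+ (b ℕ.∸ a)) ⟩
      (+ a + + (b ℕ.∸ a)) - + a ≡⟨ cong (λ x → + x - + a) (ℕ.m+[n∸m]≡n a≤b) ⟩
      + b - + a      ≈⟨ a≈b⇒a-b≈0 (≈-sym a≈b) ⟩
      0ℤ             ∎))
    where
    cancel : ∀ a d → d ≡ (a + d) - a
    cancel = solve-∀

  small-injective : ∀ {a b} → a ℕ.< p → b ℕ.< p → + a ≈ + b → a ≡ b
  small-injective {a} {b} a<p b<p a≈b with ℕ.≤-total a b
  ... | inj₁ a≤b = small-injective-≤ a≤b b<p a≈b
  ... | inj₂ b≤a = sym (small-injective-≤ b≤a a<p (≈-sym a≈b))

  2m<p : m ℕ.* 2 ℕ.< p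
  2m<p = subst (m ℕ.* 2 ℕ.<_) (sym p≡) (ℕ.n<1+n (m ℕ.* 2))

  m+m<p : m ℕ.+ m ℕ.< p
  m+m<p = subst (ℕ._< p) (trans (ℕ.*-comm m 2) (cong (m ℕ.+_) (ℕ.+-identityʳ m))) 2m<p

  m<p : m ℕ.< p
  m<p = ℕ.≤-<-trans (ℕ.m≤m+n m m) m+m<p

  factorial-unit : ∀ {n} → n ℕ.< p → + (n !) ≉ 0ℤ
  factorial-unit {zero}  _     = 1≉0
  factorial-unit {suc n} n+1<p = λ eq → *-unit (small-unit n+1<p)
    (factorial-unit (ℕ.<-trans (ℕ.n<1+n n) n+1<p))
    (≈-trans (≈-reflexive (sym (factorial-suc n))) eq)

  z : ℤ
  z = + (m !)

  -- The squares of 1, …, m run through the residues, whose product is -1.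
  z²≈-1 : z * z ≈ -1ℤ
  z²≈-1 = begin
    z * z
      ≡⟨ sym (trans (∏-toℕ m (λ e → + suc e * + suc e)) (trans (∏<-* m (λ e → + suc e) (λ e → + suc e))
           (cong₂ _*_ (∏<-factorial m) (∏<-factorial m)))) ⟩
    ∏ (λ j → root j * root j)   ≈⟨ ≈-sym (∏-cong (λ j → proj₂ (square j))) ⟩
    ∏ (λ j → α (τ j))           ≡⟨ ∏-injective α τ τ-injective ⟩
    ∏ α                         ≈⟨ ∏α≈-1 ⟩
    -1ℤ                         ∎
    where
    root : Fin m → ℤ
    root j = + suc (toℕ j)
    bound : ∀ j → suc (toℕ j) ℕ.< p
    bound j = ℕ.≤-<-trans (Fin.toℕ<n j) m<p
    root-unit : ∀ j → root j ≉ 0ℤ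
    root-unit j = small-unit (bound j)
    square : ∀ j → ∃ λ i → α i ≈ root j * root j
    square j = index (root j * root j) (*-unit (root-unit j) (root-unit j)) (root j , ≈-refl)
    τ : Fin m → Fin m
    τ = proj₁ ∘ square
    difference : ∀ x y → (x + y) * (x - y) ≡ x * x - y * y
    difference = solve-∀
    -- For roots a, b in 1, ..., m the sum a + b is at most 2m < p, hence a unit, so a² ≈ b² leaves
    -- only a = b.
    τ-injective : ∀ {i j} → τ i ≡ τ j → i ≡ j
    τ-injective {i} {j} eq = Fin.toℕ-injective (ℕ.suc-injective (small-injective (bound i) (bound j)
      (a-b≈0⇒a≈b (unit-cancel
        (small-unit (ℕ.≤-<-trans (ℕ.+-mono-≤ (Fin.toℕ<n i) (Fin.toℕ<n j)) m+m<p)) (begin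
        (root i + root j) * (root i - root j) ≡⟨ difference (root i) (root j) ⟩
        root i * root i - root j * root j     ≈⟨ a≈b⇒a-b≈0 (begin
          root i * root i ≈⟨ ≈-sym (proj₂ (square i)) ⟩
          α (τ i)         ≡⟨ cong α eq ⟩
          α (τ j)         ≈⟨ proj₂ (square j) ⟩
          root j * root j ∎) ⟩
        0ℤ ∎)))))

  -- The common value of `χ` at m!, 2, m and m + 1.
  ε : ℤ
  ε = -1ℤ ^ K

  χz≈ε : χ z ≈ ε
  χz≈ε = ≈-trans (≈-reflexive (χ≡squareᴷ z)) (^-cong K z²≈-1)

  2≉0 : + 2 ≉ 0ℤ
  2≉0 2≈0 = 1≉0 (begin
    1ℤ                 ≡⟨⟩
    - -1ℤ              ≈⟨ neg-cong (≈-sym 2m≈-1) ⟩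
    - (+ 2 * + m)      ≈⟨ neg-cong (*-congʳ (+ m) 2≈0) ⟩
    - (0ℤ * + m)       ≡⟨ cong -_ (ℤ.*-zeroˡ (+ m)) ⟩
    0ℤ                 ∎)

  -- (1 + z)² ≈ 2 z.
  χ2≈ε : χ (+ 2) ≈ ε
  χ2≈ε = inverse-sign (begin
    χ (+ 2) * ε             ≈⟨ *-congˡ (χ (+ 2)) (≈-sym χz≈ε) ⟩
    χ (+ 2) * χ z           ≡⟨ sym (χ-* (+ 2) z) ⟩
    χ (+ 2 * z)             ≈⟨ ^-cong m (begin
      + 2 * z                 ≡⟨ expand z ⟩
      1+z * 1+z + (-1ℤ - z * z) ≈⟨ +-congˡ (1+z * 1+z) (a≈b⇒a-b≈0 (≈-sym z²≈-1)) ⟩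
      1+z * 1+z + 0ℤ          ≡⟨ ℤ.+-identityʳ (1+z * 1+z) ⟩
      1+z * 1+z               ∎) ⟩
    χ (1+z * 1+z)           ≈⟨ χ-squared 1+z≉0 ⟩
    1ℤ ∎) (≈-reflexive (-1^-self-inverse K))
    where
    1+z = 1ℤ + z
    expand : ∀ z → + 2 * z ≡ (1ℤ + z) * (1ℤ + z) + (-1ℤ - z * z)
    expand = solve-∀
    conjugate : ∀ z → (1ℤ + z) * (1ℤ - z) ≡ 1ℤ - z * z
    conjugate = solve-∀
    1+z≉0 : 1+z ≉ 0ℤ
    1+z≉0 eq = 2≉0 (begin
      1ℤ - -1ℤ             ≈⟨ +-congˡ 1ℤ (neg-cong (≈-sym z²≈-1)) ⟩
      1ℤ - z * z           ≡⟨ sym (conjugate z) ⟩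
      1+z * (1ℤ - z)       ≈⟨ *-congʳ (1ℤ - z) eq ⟩
      0ℤ * (1ℤ - z)        ≡⟨ ℤ.*-zeroˡ (1ℤ - z) ⟩
      0ℤ                   ∎)

  χ2-self-inverse : χ (+ 2) * χ (+ 2) ≈ 1ℤ
  χ2-self-inverse = unit-power 2≉0

  χ-half : ∀ a {b} → + 2 * a ≈ b → χ (+ 2) * χ a ≈ χ b
  χ-half a 2a≈b = ≈-trans (≈-reflexive (sym (χ-* (+ 2) a))) (^-cong m 2a≈b)

  χm≈ε : χ (+ m) ≈ ε
  χm≈ε = ≈-trans (inverse-sign (begin
    χ (+ m) * χ (+ 2) ≡⟨ ℤ.*-comm (χ (+ m)) (χ (+ 2)) ⟩
    χ (+ 2) * χ (+ m) ≈⟨ χ-half (+ m) 2m≈-1 ⟩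
    -1ℤ ^ m           ≡⟨ -1^m≡1 ⟩
    1ℤ                ∎) χ2-self-inverse) χ2≈ε

  2[m+1]≈1 : + 2 * + suc m ≈ 1ℤ
  2[m+1]≈1 = begin
    + 2 * (1ℤ + + m)    ≡⟨ ℤ.*-distribˡ-+ (+ 2) 1ℤ (+ m) ⟩
    + 2 + + 2 * + m     ≈⟨ +-congˡ (+ 2) 2m≈-1 ⟩
    1ℤ                  ∎

  χ[m+1]≈ε : χ (+ suc m) ≈ ε
  χ[m+1]≈ε = ≈-trans (inverse-sign (begin
    χ (+ suc m) * χ (+ 2) ≡⟨ ℤ.*-comm (χ (+ suc m)) (χ (+ 2)) ⟩
    χ (+ 2) * χ (+ suc m) ≈⟨ χ-half (+ suc m) 2[m+1]≈1 ⟩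
    1ℤ ^ m                ≡⟨ ℤ.^-zeroˡ m ⟩
    1ℤ                    ∎) χ2-self-inverse) χ2≈ε

  χ[m+2] : χ (+ 2) * χ (+ suc (suc m)) ≈ χ (+ 3)
  χ[m+2] = χ-half (+ suc (suc m)) (begin
    + 2 * (1ℤ + + suc m) ≡⟨ ℤ.*-distribˡ-+ (+ 2) 1ℤ (+ suc m) ⟩
    + 2 + + 2 * + suc m  ≈⟨ +-congˡ (+ 2) 2[m+1]≈1 ⟩
    + 3                  ∎)

  χ[m+1]!≈1 : χ (+ (suc m !)) ≈ 1ℤ
  χ[m+1]!≈1 = begin
    χ (+ (suc m !))      ≡⟨ trans (cong χ (factorial-suc m)) (χ-* (+ suc m) z) ⟩
    χ (+ suc m) * χ z    ≈⟨ *-cong χ[m+1]≈ε χz≈ε ⟩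
    ε * ε                ≡⟨ -1^-self-inverse K ⟩
    1ℤ                   ∎

  -- The quadratic character of the product of binomial coefficients

  -- `F` is 2! · 3! ⋯ (m - 1)!. Pairing each (2i)! with (2i + 1)! = (2i + 1) (2i)! leaves the square
  -- of `B` and the odd numbers 3, 5, ..., m - 1 of `D`.
  F D B : ℤ
  F = ∏< N (λ e → + (suc (suc e) !))
  D = ∏< k (λ i → + suc (suc (suc (i ℕ.* 2))))
  B = ∏< k (λ i → + (suc (suc (i ℕ.* 2)) !))

  F≡B²D : F ≡ B * B * D
  F≡B²D = trans (∏<-even k (λ e → + (suc (suc e) !))) (trans
    (∏<-cong k (λ i _ → trans (cong (b i *_) (factorial-suc (suc (suc (i ℕ.* 2)))))
      (regroup (b i) (d i))))
    (trans (∏<-* k (λ i → b i * b i) d) (cong (_* D) (∏<-* k b b))))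
    where
    b d : ℕ → ℤ
    b i = + (suc (suc (i ℕ.* 2)) !)
    d i = + suc (suc (suc (i ℕ.* 2)))
    regroup : ∀ x y → x * (y * x) ≡ x * x * y
    regroup = solve-∀

  D-factorial : D * (+ 2) ^ K * + (K !) ≡ z
  D-factorial = trans (double-factorial k) (cong (λ n → + (n !)) (sym m≡))

  N<p : N ℕ.< p
  N<p = ℕ.<-trans (subst (N ℕ.<_) (sym m≡) (ℕ.m<n⇒m<1+n (ℕ.n<1+n N))) m<p

  K<p : K ℕ.< p
  K<p = ℕ.≤-<-trans (subst (K ℕ.≤_) (sym m≡) (ℕ.m≤m*n K 2)) m<p

  K!-unit : + (K !) ≉ 0ℤ
  K!-unit = factorial-unit K<p

  ∏<-unit : ∀ n {f} → (∀ i → i ℕ.< n → f i ≉ 0ℤ) → ∏< n f ≉ 0ℤ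
  ∏<-unit zero    f≉0 = 1≉0
  ∏<-unit (suc n) f≉0 = *-unit (∏<-unit n λ i i<n → f≉0 i (ℕ.m≤n⇒m≤1+n i<n)) (f≉0 n (ℕ.n<1+n n))

  -- The square `B * B` drops out, and in D · 2^K · K! = m! both 2^K and m! have character `ε`, so
  -- `D` and K! have the same one.
  χF≈χK! : χ F ≈ χ (+ (K !))
  χF≈χK! = begin
    χ F                ≡⟨ trans (cong χ F≡B²D) (χ-* (B * B) D) ⟩
    χ (B * B) * χ D    ≈⟨ *-congʳ (χ D) (χ-squared B-unit) ⟩
    1ℤ * χ D           ≡⟨ ℤ.*-identityˡ (χ D) ⟩
    χ D                ≈⟨ inverse-sign χD·χK!≈1 (unit-power K!-unit) ⟩
    χ (+ (K !))        ∎
    where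
    B-unit : B ≉ 0ℤ
    B-unit = ∏<-unit k λ i i<k → factorial-unit (ℕ.≤-<-trans (ℕ.*-monoˡ-≤ 2 i<k) N<p)
    regroup : ∀ e d x → e * (d * e * x) ≡ e * e * (d * x)
    regroup = solve-∀
    χD·χK!≈1 : χ D * χ (+ (K !)) ≈ 1ℤ
    χD·χK!≈1 = begin
      χ D * χ (+ (K !))               ≡⟨ sym (ℤ.*-identityˡ _) ⟩
      1ℤ * (χ D * χ (+ (K !)))        ≡⟨ cong (_* (χ D * χ (+ (K !)))) (sym (-1^-self-inverse K)) ⟩
      ε * ε * (χ D * χ (+ (K !)))     ≡⟨ sym (regroup ε (χ D) (χ (+ (K !)))) ⟩
      ε * (χ D * ε * χ (+ (K !)))
        ≈⟨ *-congˡ ε (*-congʳ (χ (+ (K !))) (*-congˡ (χ D) (≈-sym χ2ᴷ≈ε))) ⟩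
      ε * (χ D * χ ((+ 2) ^ K) * χ (+ (K !)))
        ≡⟨ cong (ε *_) (sym (trans (χ-* (D * (+ 2) ^ K) (+ (K !)))
             (cong (_* χ (+ (K !))) (χ-* D ((+ 2) ^ K))))) ⟩
      ε * χ (D * (+ 2) ^ K * + (K !)) ≡⟨ cong (λ x → ε * χ x) D-factorial ⟩
      ε * χ z                         ≈⟨ *-congˡ ε χz≈ε ⟩
      ε * ε                           ≡⟨ -1^-self-inverse K ⟩
      1ℤ                              ∎
      where
      χ2ᴷ≈ε : χ ((+ 2) ^ K) ≈ ε
      χ2ᴷ≈ε = begin
        χ ((+ 2) ^ K)     ≡⟨ ^-comm-exponents (+ 2) K m ⟩
        χ (+ 2) ^ K       ≈⟨ ^-cong K χ2≈ε ⟩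
        ε ^ K             ≡⟨ -1^-square K ⟩
        ε                 ∎

  -- Each C(m + 1, r) r! (m + 1 - r)! is (m + 1)!. As r runs from 2 to m - 1, so does m + 1 - r, and
  -- either family of factorials multiplies to `F`.
  Q·F²≡[m+1]!ᴺ : Q * F * F ≡ (+ (suc m !)) ^ N
  Q·F²≡[m+1]!ᴺ = trans (ℤ.*-assoc Q F F) (trans
    (cong (λ x → Q * (F * x)) (sym (∏<-reverse N (λ e → + (suc (suc e) !)))))
    (trans (cong (Q *_) (sym (∏<-* N (λ e → + (suc (suc e) !)) (λ e → + (suc (suc (N ℕ.∸ suc e)) !)))))
    (trans (sym (∏<-* N (λ e → binom (suc (suc e))) (λ e → + (suc (suc e) !) * + (suc (suc (N ℕ.∸ suc e)) !))))
    (trans (∏<-cong N term) (∏<-const N (+ (suc m !)))))))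
    where
    complement : ∀ e → e ℕ.< N → suc m ℕ.∸ suc (suc e) ≡ suc (suc (N ℕ.∸ suc e))
    complement e e<N = trans (cong (ℕ._∸ suc e) m≡) (ℕ.+-∸-assoc 2 e<N)
    term : ∀ e → e ℕ.< N →
      binom (suc (suc e)) * (+ (suc (suc e) !) * + (suc (suc (N ℕ.∸ suc e)) !)) ≡ + (suc m !)
    term e e<N = trans
      (cong (λ n → binom (suc (suc e)) * (+ (suc (suc e) !) * + (n !))) (sym (complement e e<N)))
      (binomial-factorials (ℕ.s≤s (subst (suc e ℕ.≤_) (sym m≡) (ℕ.m≤n⇒m≤1+n (ℕ.m≤n⇒m≤1+n e<N)))))

  -- Take K-th powers in the previous identity: F^(2K) is `χ F`, and N K = m k makes the right side
  -- a power of the character of (m + 1)!, which is 1.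
  Qᴷ≈χK! : Q ^ K ≈ χ (+ (K !))
  Qᴷ≈χK! = ≈-trans (inverse-sign (begin
    Q ^ K * χ F                 ≡⟨ cong (Q ^ K *_) (χ≡squareᴷ F) ⟩
    Q ^ K * (F * F) ^ K         ≡⟨ sym (^-distribʳ-* Q (F * F) K) ⟩
    (Q * (F * F)) ^ K           ≡⟨ cong (_^ K) (trans (sym (ℤ.*-assoc Q F F)) Q·F²≡[m+1]!ᴺ) ⟩
    ((+ (suc m !)) ^ N) ^ K     ≡⟨ trans (ℤ.^-*-assoc (+ (suc m !)) N K) (trans
                                     (cong ((+ (suc m !)) ^_) exponents) (sym (ℤ.^-*-assoc (+ (suc m !)) m k))) ⟩
    χ (+ (suc m !)) ^ k         ≈⟨ ^-cong k χ[m+1]!≈1 ⟩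
    1ℤ ^ k                      ≡⟨ ℤ.^-zeroˡ k ⟩
    1ℤ ∎) (≈-trans (*-cong χF≈χK! χF≈χK!) (unit-power K!-unit))) χF≈χK!
    where
    exponents : N ℕ.* K ≡ m ℕ.* k
    exponents = trans (ℕ.*-assoc k 2 K) (trans (ℕ.*-comm k (2 ℕ.* K))
      (cong (ℕ._* k) (trans (ℕ.*-comm 2 K) (sym m≡))))

  -- The factor m^m is (-1)^K and cancels against (-1)^k up to one -1. Its K-th power is `ε`, the
  -- character of 2, which combines with that of m + 2 because 2(m + 2) ≈ 3.
  det-Mᴷ : det M ^ K ≈ χ (+ 3) * χ (+ (K !))
  det-Mᴷ = begin
    det M ^ K                                       ≈⟨ ^-cong K det-M ⟩
    (n² * (χ (+ m) * (-1ℤ ^ k * Q))) ^ K            ≈⟨ ^-cong K (*-congˡ n² (*-congʳ (-1ℤ ^ k * Q) χm≈ε)) ⟩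
    (n² * (ε * (-1ℤ ^ k * Q))) ^ K                  ≡⟨ cong (λ x → (n² * x) ^ K) sign ⟩
    (n² * (-1ℤ * Q)) ^ K                            ≡⟨ trans (^-distribʳ-* n² (-1ℤ * Q) K)
                                                        (cong₂ _*_ (sym (χ≡squareᴷ n)) (^-distribʳ-* -1ℤ Q K)) ⟩
    χ n * (ε * Q ^ K)                               ≈⟨ *-congˡ (χ n) (*-cong (≈-sym χ2≈ε) Qᴷ≈χK!) ⟩
    χ n * (χ (+ 2) * χ (+ (K !)))                   ≡⟨ regroup (χ n) (χ (+ 2)) (χ (+ (K !))) ⟩
    χ (+ 2) * χ n * χ (+ (K !))                     ≈⟨ *-congʳ (χ (+ (K !))) χ[m+2] ⟩
    χ (+ 3) * χ (+ (K !)) ∎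
    where
    n n² : ℤ
    n = + suc (suc m)
    n² = n * n
    regroup : ∀ a b c → a * (b * c) ≡ b * a * c
    regroup = solve-∀
    pull : ∀ s q → -1ℤ * s * (s * q) ≡ -1ℤ * (s * s * q)
    pull = solve-∀
    sign : ε * (-1ℤ ^ k * Q) ≡ -1ℤ * Q
    sign = trans (pull (-1ℤ ^ k) Q) (cong (-1ℤ *_) (trans
      (cong (_* Q) (-1^-self-inverse k)) (ℤ.*-identityˡ Q)))

  -- The quadratic character of 3

  p≡1+4K : p ≡ suc (K ℕ.* 2 ℕ.* 2)
  p≡1+4K = trans p≡ (cong (λ n → suc (n ℕ.* 2)) m≡)

  3<p : 3 ℕ.< p
  3<p = subst (3 ℕ.<_) (sym p≡1+4K) (ℕ.s≤s (ℕ.s≤s (ℕ.s≤s (ℕ.s≤s ℕ.z≤n))))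

  3≉0 : + 3 ≉ 0ℤ
  3≉0 = small-unit 3<p

  1≉-1 : 1ℤ ≉ -1ℤ
  1≉-1 = 2≉0 ∘ a≈b⇒a-b≈0

  -- If ω² + ω + 1 ≈ 0 then (2 ω + 1)² ≈ -3.
  χ3-root : ∀ ω → ω * ω + ω + 1ℤ ≈ 0ℤ → χ (+ 3) ≈ 1ℤ
  χ3-root ω root = begin
    χ (+ 3)            ≡⟨ sym (ℤ.*-identityˡ (χ (+ 3))) ⟩
    1ℤ * χ (+ 3)       ≡⟨ cong (_* χ (+ 3)) (sym -1^m≡1) ⟩
    χ -1ℤ * χ (+ 3)    ≡⟨ sym (χ-* -1ℤ (+ 3)) ⟩
    χ (- + 3)          ≈⟨ ^-cong m (≈-sym square) ⟩
    χ (v * v)          ≈⟨ χ-squared v≉0 ⟩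
    1ℤ                 ∎
    where
    v = + 2 * ω + 1ℤ
    complete-square : ∀ ω → (+ 2 * ω + 1ℤ) * (+ 2 * ω + 1ℤ) ≡ + 4 * (ω * ω + ω + 1ℤ) - + 3
    complete-square = solve-∀
    square : v * v ≈ - + 3
    square = begin
      v * v                              ≡⟨ complete-square ω ⟩
      + 4 * (ω * ω + ω + 1ℤ) - + 3       ≈⟨ +-cong (*-congˡ (+ 4) root) (≈-refl { - + 3}) ⟩
      - + 3                              ∎
    v≉0 : v ≉ 0ℤ
    v≉0 v≈0 = 3≉0 (neg-cong { - + 3} {0ℤ} (≈-trans (≈-sym square)
      (≈-trans (*-congʳ v v≈0) (≈-reflexive (ℤ.*-zeroˡ v)))))

  χ3-cube-root : ∀ x → x ≉ 1ℤ → x ^ 3 ≈ 1ℤ → χ (+ 3) ≈ 1ℤ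
  χ3-cube-root x x≉1 x³≈1 = χ3-root x (unit-cancel {x - 1ℤ} (x≉1 ∘ a-b≈0⇒a≈b)
    (≈-trans (≈-reflexive (sym (cube-minus-one x))) (a≈b⇒a-b≈0 x³≈1)))

  -- Now 3 divides m, so the (m/3)-th power of a residue is a cube root of unity, and some residue
  -- gives one different from 1.
  χ3-case₁ : ∀ t → K ≡ t ℕ.* 3 → χ (+ 3) ≈ 1ℤ
  χ3-case₁ (suc t) K≡ = from-power (nontrivial-power e d<m)
    where
    e : ℕ
    e = suc (t ℕ.* 2)
    m≡d*3 : m ≡ suc e ℕ.* 3
    m≡d*3 = trans m≡ (trans (cong (ℕ._* 2) K≡) (swap (suc t)))
      where
      swap : ∀ t → t ℕ.* 3 ℕ.* 2 ≡ t ℕ.* 2 ℕ.* 3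
      swap = ℕ-solve-∀
    d<m : suc e ℕ.< m
    d<m = subst (suc e ℕ.<_) (sym m≡d*3) (ℕ.m<m*n (suc e) 3 (ℕ.s≤s (ℕ.s≤s ℕ.z≤n)))
    power-cube : ∀ a d → m ≡ d ℕ.* 3 → a ^ m ≈ 1ℤ → (a ^ d) ^ 3 ≈ 1ℤ
    power-cube a d m≡ aᵐ≈1 = ≈-trans
      (≈-reflexive (trans (ℤ.^-*-assoc a d 3) (cong (a ^_) (sym m≡)))) aᵐ≈1
    from-power : (∃ λ i → α i ^ suc e ≉ 1ℤ) → χ (+ 3) ≈ 1ℤ
    from-power (i , x≉1) = χ3-cube-root (α i ^ suc e) x≉1
      (power-cube (α i) (suc e) m≡d*3 (square-power (α-unit i) (α-square i)))

  -- A square root of 3 gives a primitive cube root of unity, but the order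
  -- of the unit group is 1 modulo 3.
  χ3-case₂ : ∀ t → K ≡ 1 ℕ.+ t ℕ.* 3 → χ (+ 3) ≈ -1ℤ
  χ3-case₂ t K≡ = nonsquare-power 3≉0 λ { (w , w²≈3) → contradiction₃ w w²≈3 }
    where
    h = + suc m
    module _ (w : ℤ) (w²≈3 : w * w ≈ + 3) where
      -- As z² ≈ -1, `v` is a square root of -3; `h` inverts 2, so `ω` is (-1 + √-3)/2.
      v ω : ℤ
      v = z * w
      ω = h * (v - 1ℤ)

      v²≈-3 : v * v ≈ - + 3
      v²≈-3 = begin
        z * w * (z * w)   ≡⟨ interchange z w ⟩
        z * z * (w * w)   ≈⟨ *-cong z²≈-1 w²≈3 ⟩
        - + 3             ∎
        where
        interchange : ∀ z w → z * w * (z * w) ≡ z * z * (w * w)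
        interchange = solve-∀

      2ω+1≈v : + 2 * ω + 1ℤ ≈ v
      2ω+1≈v = begin
        + 2 * (h * (v - 1ℤ)) + 1ℤ   ≡⟨ cong (_+ 1ℤ) (sym (ℤ.*-assoc (+ 2) h (v - 1ℤ))) ⟩
        + 2 * h * (v - 1ℤ) + 1ℤ     ≈⟨ +-cong (*-congʳ (v - 1ℤ) 2[m+1]≈1) (≈-refl {1ℤ}) ⟩
        1ℤ * (v - 1ℤ) + 1ℤ          ≡⟨ cancel v ⟩
        v                           ∎
        where
        cancel : ∀ v → 1ℤ * (v - 1ℤ) + 1ℤ ≡ v
        cancel = solve-∀

      ω-root : ω * ω + ω + 1ℤ ≈ 0ℤ
      ω-root = unit-cancel (*-unit 2≉0 2≉0) (begin
        + 4 * (ω * ω + ω + 1ℤ)                      ≡⟨ complete-square ω ⟩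
        (+ 2 * ω + 1ℤ) * (+ 2 * ω + 1ℤ) - - + 3     ≈⟨ a≈b⇒a-b≈0 (≈-trans (*-cong 2ω+1≈v 2ω+1≈v) v²≈-3) ⟩
        0ℤ                                          ∎)
        where
        complete-square : ∀ ω → + 4 * (ω * ω + ω + 1ℤ) ≡ (+ 2 * ω + 1ℤ) * (+ 2 * ω + 1ℤ) - - + 3
        complete-square = solve-∀

      ω³≈1 : ω ^ 3 ≈ 1ℤ
      ω³≈1 = a-b≈0⇒a≈b (begin
        ω ^ 3 - 1ℤ                    ≡⟨ cube-minus-one ω ⟩
        (ω - 1ℤ) * (ω * ω + ω + 1ℤ)   ≈⟨ *-congˡ (ω - 1ℤ) ω-root ⟩
        (ω - 1ℤ) * 0ℤ                 ≡⟨ ℤ.*-zeroʳ (ω - 1ℤ) ⟩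
        0ℤ                            ∎)

      ω≉0 : ω ≉ 0ℤ
      ω≉0 ω≈0 = 1≉0 (≈-trans (≈-sym ω³≈1) (^-cong 3 ω≈0))

      -- Fermat gives ω^(p-1) ≈ 1, and p - 1 = 3 (4t + 1) + 1.
      ω≈1 : ω ≈ 1ℤ
      ω≈1 = begin
        ω                                  ≡⟨ sym (ℤ.*-identityʳ ω) ⟩
        ω * 1ℤ                             ≡⟨ cong (ω *_) (sym (ℤ.^-zeroˡ (suc (t ℕ.* 4)))) ⟩
        ω * 1ℤ ^ suc (t ℕ.* 4)             ≈⟨ *-congˡ ω (^-cong (suc (t ℕ.* 4)) (≈-sym ω³≈1)) ⟩
        ω * (ω ^ 3) ^ suc (t ℕ.* 4)        ≡⟨ cong (ω *_) (ℤ.^-*-assoc ω 3 (suc (t ℕ.* 4))) ⟩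
        ω ^ suc (3 ℕ.* suc (t ℕ.* 4))      ≡⟨ cong (ω ^_) exponent ⟩
        ω ^ (m ℕ.* 2)                      ≡⟨ ^-double ω m ⟩
        χ (ω * ω)                          ≈⟨ χ-squared ω≉0 ⟩
        1ℤ                                 ∎
        where
        arithmetic : ∀ t → suc (3 ℕ.* suc (t ℕ.* 4)) ≡ (1 ℕ.+ t ℕ.* 3) ℕ.* 2 ℕ.* 2
        arithmetic = ℕ-solve-∀
        exponent : suc (3 ℕ.* suc (t ℕ.* 4)) ≡ m ℕ.* 2
        exponent = trans (arithmetic t) (cong (ℕ._* 2) (sym (trans m≡ (cong (ℕ._* 2) K≡))))

      contradiction₃ : ⊥
      contradiction₃ = 3≉0 (≈-trans (≈-sym (+-cong (+-cong (*-cong ω≈1 ω≈1) ω≈1) (≈-refl {1ℤ}))) ω-root)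

  -- Modulo 3, p = 4K + 1 is K + 1. The class of K decides both symbols, and K = 2 modulo 3 would
  -- make 3 divide p.
  χ3≈legendre : χ (+ 3) ≈ legendre (+ p) 3
  χ3≈legendre = decide (residue-mod-3 K)
    where
    decide : (∃ λ t → K ≡ t ℕ.* 3 ⊎ K ≡ 1 ℕ.+ t ℕ.* 3 ⊎ K ≡ 2 ℕ.+ t ℕ.* 3) →
       χ (+ 3) ≈ legendre (+ p) 3
    decide (t , inj₁ K≡) = ≈-trans (χ3-case₁ t K≡) (≈-reflexive (sym (legendre-1-mod-3 (t ℕ.* 4) p≡3q+1)))
      where
      arithmetic : ∀ t → suc (t ℕ.* 3 ℕ.* 2 ℕ.* 2) ≡ 1 ℕ.+ t ℕ.* 4 ℕ.* 3
      arithmetic = ℕ-solve-∀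
      p≡3q+1 : p ≡ 1 ℕ.+ t ℕ.* 4 ℕ.* 3
      p≡3q+1 = trans p≡1+4K (trans (cong (λ n → suc (n ℕ.* 2 ℕ.* 2)) K≡) (arithmetic t))
    decide (t , inj₂ (inj₁ K≡)) = ≈-trans (χ3-case₂ t K≡)
      (≈-reflexive (sym (legendre-2-mod-3 (1 ℕ.+ t ℕ.* 4) p≡3q+2)))
      where
      arithmetic : ∀ t → suc ((1 ℕ.+ t ℕ.* 3) ℕ.* 2 ℕ.* 2) ≡ 2 ℕ.+ (1 ℕ.+ t ℕ.* 4) ℕ.* 3
      arithmetic = ℕ-solve-∀
      p≡3q+2 : p ≡ 2 ℕ.+ (1 ℕ.+ t ℕ.* 4) ℕ.* 3
      p≡3q+2 = trans p≡1+4K (trans (cong (λ n → suc (n ℕ.* 2 ℕ.* 2)) K≡) (arithmetic t))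
    decide (t , inj₂ (inj₂ K≡)) = ⊥-elim (3∤p (ℕ.divides (3 ℕ.+ t ℕ.* 4) p≡3q))
      where
      arithmetic : ∀ t → suc ((2 ℕ.+ t ℕ.* 3) ℕ.* 2 ℕ.* 2) ≡ (3 ℕ.+ t ℕ.* 4) ℕ.* 3
      arithmetic = ℕ-solve-∀
      p≡3q : p ≡ (3 ℕ.+ t ℕ.* 4) ℕ.* 3
      p≡3q = trans p≡1+4K (trans (cong (λ n → suc (n ℕ.* 2 ℕ.* 2)) K≡) (arithmetic t))
      3∤p : ¬ (3 ℕ.∣ p)
      3∤p 3∣p with prime⇒irreducible p-prime 3∣p
      ... | inj₁ ()
      ... | inj₂ 3≡p = ℕ.<⇒≢ 3<p 3≡p

  -- Counting nonresidues below p/4, and the final comparison of signs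

  IsSign-≈⇒≡ : ∀ {a b} → IsSign a → IsSign b → a ≈ b → a ≡ b
  IsSign-≈⇒≡ null  null  _  = refl
  IsSign-≈⇒≡ null  plus  eq = contradiction (≈-sym eq) 1≉0
  IsSign-≈⇒≡ null  minus eq = contradiction (neg-cong (≈-sym eq)) 1≉0
  IsSign-≈⇒≡ plus  null  eq = contradiction eq 1≉0
  IsSign-≈⇒≡ plus  plus  _  = refl
  IsSign-≈⇒≡ plus  minus eq = contradiction eq 1≉-1
  IsSign-≈⇒≡ minus null  eq = contradiction (neg-cong eq) 1≉0
  IsSign-≈⇒≡ minus plus  eq = contradiction (≈-sym eq) 1≉-1
  IsSign-≈⇒≡ minus minus _  = refl

  -- This has to be the predicate filtered in `nonresiduesBelowQuarter` verbatim, so that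
  -- `-1^-count` applies definitionally.
  Counted : ℕ → Set
  Counted r = 0 ℕ.< r × 4 ℕ.* r ℕ.< p × legendre (+ r) p ≡ -1ℤ

  counted? : ∀ r → Dec (Counted r)
  counted? r = (0 ℕ.<? r) ×-dec (4 ℕ.* r ℕ.<? p) ×-dec (legendre (+ r) p ℤ.≟ -1ℤ)

  sign : ℕ → ℤ
  sign r = if does (counted? r) then -1ℤ else 1ℤ

  sign-uncounted : ∀ {r} → ¬ Counted r → sign r ≡ 1ℤ
  sign-uncounted {r} ¬c = cong (λ b → if b then -1ℤ else 1ℤ) (dec-false (counted? r) ¬c)

  p≡1+K*4 : p ≡ suc (4 ℕ.* K)
  p≡1+K*4 = trans p≡1+4K (cong suc (arithmetic K))
    where
    arithmetic : ∀ K → K ℕ.* 2 ℕ.* 2 ≡ 4 ℕ.* K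
    arithmetic = ℕ-solve-∀

  sign≈χ : ∀ e → e ℕ.< K → sign (suc e) ≈ χ (+ suc e)
  sign≈χ e e<K = decide (legendre-isSign (+ r) p) refl
    where
    r = suc e
    r-unit : + r ≉ 0ℤ
    r-unit = small-unit (ℕ.≤-<-trans e<K K<p)
    4r<p : 4 ℕ.* r ℕ.< p
    4r<p = subst (4 ℕ.* r ℕ.<_) (sym p≡1+K*4) (ℕ.s≤s (ℕ.*-monoʳ-≤ 4 e<K))
    decide : ∀ {l} → IsSign l → legendre (+ r) p ≡ l → sign r ≈ χ (+ r)
    decide null eq = contradiction (begin
      1ℤ                ≈⟨ ≈-sym (unit-power r-unit) ⟩
      χ (+ r) * χ (+ r) ≈⟨ *-congʳ (χ (+ r)) (≈-trans (≈-sym (legendre≈ (+ r))) (≈-reflexive eq)) ⟩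
      0ℤ * χ (+ r)      ≡⟨ ℤ.*-zeroˡ (χ (+ r)) ⟩
      0ℤ                ∎) 1≉0
    decide plus eq = begin
      sign r            ≡⟨ sign-uncounted (λ { (_ , _ , eq′) → minus≢plus (trans (sym eq′) eq) }) ⟩
      1ℤ                ≡⟨ sym eq ⟩
      legendre (+ r) p  ≈⟨ legendre≈ (+ r) ⟩
      χ (+ r)           ∎
      where
      minus≢plus : -1ℤ ≢ 1ℤ
      minus≢plus ()
    decide minus eq = begin
      sign r            ≡⟨ cong (λ b → if b then -1ℤ else 1ℤ) (dec-true (counted? r) (ℕ.s≤s ℕ.z≤n , 4r<p , eq)) ⟩
      -1ℤ               ≡⟨ sym eq ⟩
      legendre (+ r) p  ≈⟨ legendre≈ (+ r) ⟩
      χ (+ r)           ∎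

  -1^nonresidues≡∏ : -1ℤ ^ nonresiduesBelowQuarter p ≡ ∏< p sign
  -1^nonresidues≡∏ = -1^-count counted? p

  -- Since p = 4K + 1, 4r < p means r ≤ K. The index 0 and all indices above K contribute 1.
  ∏-sign : ∏< p sign ≡ ∏< K (sign ∘ suc)
  ∏-sign = trans (cong (λ n → ∏< n sign) p≡K+1+3K) (trans
    (∏<-trivial-tail (suc K) (3 ℕ.* K) sign (λ i → sign-uncounted (beyond i)))
    (trans (∏<-first K sign) (trans
      (cong (_* ∏< K (sign ∘ suc)) (sign-uncounted {0} λ ())) (ℤ.*-identityˡ (∏< K (sign ∘ suc))))))
    where
    arithmetic : ∀ K → suc (4 ℕ.* K) ≡ suc K ℕ.+ 3 ℕ.* K
    arithmetic = ℕ-solve-∀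
    p≡K+1+3K : p ≡ suc K ℕ.+ 3 ℕ.* K
    p≡K+1+3K = trans p≡1+K*4 (arithmetic K)
    beyond : ∀ i → ¬ Counted (suc K ℕ.+ i)
    beyond i (_ , 4r<p , _) = ℕ.<⇒≱ 4r<p (subst (ℕ._≤ 4 ℕ.* (suc K ℕ.+ i)) (sym p≡1+K*4)
      (ℕ.≤-trans (ℕ.s≤s (ℕ.m≤n+m (4 ℕ.* K) 3)) (ℕ.≤-trans (ℕ.≤-reflexive (sym (ℕ.*-suc 4 K)))
        (ℕ.*-monoʳ-≤ 4 (ℕ.m≤m+n (suc K) i)))))

  ∏-χ : ∏< K (λ e → χ (+ suc e)) ≡ χ (+ (K !))
  ∏-χ = trans (∏<-^ K (λ e → + suc e) m) (cong χ (∏<-factorial K))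

  -1^nonresidues : -1ℤ ^ nonresiduesBelowQuarter p ≈ χ (+ (K !))
  -1^nonresidues = ≈-trans (≈-reflexive (trans -1^nonresidues≡∏ ∏-sign))
    (≈-trans (∏<-≈ K sign≈χ) (≈-reflexive ∏-χ))

  χ-root : ∀ s → s ^ 2 ≡ det M → χ s ≈ χ (+ 3) * χ (+ (K !))
  χ-root s s²≡det = ≈-trans (≈-reflexive (trans (χ≡squareᴷ s)
    (cong (_^ K) (trans (cong (s *_) (sym (ℤ.*-identityʳ s))) s²≡det)))) det-Mᴷ

  -- Stated for arbitrary signs to keep the Legendre symbols from unfolding.
  sign-product : ∀ {l e f x} → IsSign l → IsSign e → IsSign f →
    l ≈ x → x ≈ χ (+ 3) * χ (+ (K !)) → χ (+ 3) ≈ f → e ≈ χ (+ (K !)) → l ≡ e * f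
  sign-product {l} {e} {f} {x} l-sign e-sign f-sign l≈x x≈ 3≈f e≈K! =
    IsSign-≈⇒≡ l-sign (IsSign-* e-sign f-sign) (begin
    l                         ≈⟨ ≈-trans l≈x x≈ ⟩
    χ (+ 3) * χ (+ (K !))     ≡⟨ ℤ.*-comm (χ (+ 3)) (χ (+ (K !))) ⟩
    χ (+ (K !)) * χ (+ 3)     ≈⟨ *-cong (≈-sym e≈K!) 3≈f ⟩
    e * f                     ∎)

  legendre-root : ∀ s → s ^ 2 ≡ det M →
    legendre s p ≡ -1ℤ ^ nonresiduesBelowQuarter p * legendre (+ p) 3
  legendre-root s s²≡det = sign-product
    {legendre s p} { -1ℤ ^ nonresiduesBelowQuarter p} {legendre (+ p) 3} {χ s}
    (legendre-isSign s p) (-1^-isSign (nonresiduesBelowQuarter p)) (legendre-isSign (+ p) 3)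
    (legendre≈ s) (χ-root s s²≡det) χ3≈legendre -1^nonresidues

-- Existence of the root and the theorem

-- With the order a variable, its equation can be matched by `refl`; `half p` itself could not be
-- rewritten that way.
even-skew-det-square : ∀ {m} k → m ≡ k ℕ.* 2 → (A : Matrix m) → IsSkew A → ∃ λ s → s ^ 2 ≡ det A
even-skew-det-square k refl = skew-det-square k

odd-power-isSkew : ∀ {m} n (α : Fin m → ℤ) → -1ℤ ^ n ≡ -1ℤ → IsSkew (λ i j → (α i + -1ℤ * α j) ^ n)
odd-power-isSkew n α odd i j = trans (cong (_^ n) (antisymmetric (α i) (α j)))
  (trans (^-distribʳ-* -1ℤ (α j + -1ℤ * α i) n)
    (trans (cong (_* (α j + -1ℤ * α i) ^ n) odd) (ℤ.-1*i≡-i ((α j + -1ℤ * α i) ^ n))))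
  where
  antisymmetric : ∀ x y → x + -1ℤ * y ≡ -1ℤ * (y + -1ℤ * x)
  antisymmetric = solve-∀

p≡1+[p/4]*4 : ∀ p → p ℕ.% 4 ≡ 1 → p ≡ suc (p ℕ./ 4 ℕ.* 2 ℕ.* 2)
p≡1+[p/4]*4 p p%4≡1 = trans (ℕ.m≡m%n+[m/n]*n p 4)
  (cong₂ ℕ._+_ p%4≡1 (sym (ℕ.*-assoc (p ℕ./ 4) 2 2)))

half≡ : ∀ {p} n → p ≡ suc (n ℕ.* 2) → half p ≡ n
half≡ n refl = ℕ.m*n/n≡m n 2

corollary1p10 : ∀ (p : ℕ) → Prime p → p ℕ.% 4 ≡ 1 →
    ∀ (α : Fin (half p) → ℤ) → RepresentsResidues p α →
    (∃ λ (s : ℤ) → s ^ 2 ≡ S (1 ℕ.+ half p) α -1ℤ) ×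
    (∀ (s : ℤ) → s ^ 2 ≡ S (1 ℕ.+ half p) α -1ℤ →
    legendre s p ≡ -1ℤ ^ nonresiduesBelowQuarter p * legendre (+ p) 3)
corollary1p10 p p-prime p%4≡1 α represents = from-quarter (p ℕ./ 4) (p≡1+[p/4]*4 p p%4≡1)
  where
  open RepresentsResidues represents
  -- Generalizing p / 4 to a variable allows the case split; K = 0 would mean p = 1.
  from-quarter : ∀ K → p ≡ suc (K ℕ.* 2 ℕ.* 2) →
    (∃ λ (s : ℤ) → s ^ 2 ≡ S (1 ℕ.+ half p) α -1ℤ) ×
    (∀ (s : ℤ) → s ^ 2 ≡ S (1 ℕ.+ half p) α -1ℤ →
    legendre s p ≡ -1ℤ ^ nonresiduesBelowQuarter p * legendre (+ p) 3)
  from-quarter zero    p≡1 = contradiction p≡1 (ℕ.nonTrivial⇒≢1 {{prime⇒nonTrivial p-prime}})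
  from-quarter (suc k) p≡  =
    even-skew-det-square (suc k) half≡2K (λ i j → (α i + -1ℤ * α j) ^ suc (half p))
      (odd-power-isSkew (suc (half p)) α
        (cong (-1ℤ *_) (trans (cong (-1ℤ ^_) half≡2K) (-1^even (suc k))))) ,
    Residues.legendre-root p p-prime (half p) k
      (trans p≡ (cong (λ n → suc (n ℕ.* 2)) (sym half≡2K))) half≡2K α residue distinct complete
    where
    half≡2K : half p ≡ suc k ℕ.* 2
    half≡2K = half≡ (suc k ℕ.* 2) p≡
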